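{- Let $k$ and $\ell$ be positive integers and write $m:=2^{\mathrm{ord}_2(\gcd(k,\ell))}$. Suppose that $q:=2^k$ and $Q:=2^\ell$ satisfy $\gcd(Q-1,q+1)=1$. Write $A(X):=1+aX^u+dX^v$ where $a,d\in\mathbb{F}_q$ and $u,v$ are positive integers such that $u(Q-1)\equiv Q\pmod{q+1}$ and $v(Q-1)\equiv q\pmod{q+1}$. Then $f(X):=XA(X^{q-1})$ permutes $\mathbb{F}_{q^2}$ if and only if all of the following hold: (1) $e:=1+a^2+d^2$ is nonzero; (2) $d^Q=e^{Q-1}a$; (3) $\mathrm{Tr}_{\mathbb{F}_q/\mathbb{F}_{2^m}}\Bigl(\frac{a^2+d^2}{e}\Bigr)=0$.
   Context: For a positive integer $n$, $\mathrm{ord}_2(n)$ is the largest integer $i\ge0$ with $2^i\mid n$. A polynomial permutes $\mathbb{F}_{q^2}$ if it induces a bijection of $\mathbb{F}_{q^2}$. $\mathrm{Tr}_{\mathbb{F}_q/\mathbb{F}_{2^m}}$ is the trace map (note $m\mid k$). -}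

module Defs where

open import Algebra.Bundles using (CommutativeRing; Semiring)
import Algebra.Definitions.RawSemiring as RawSemiringDefs
open import Algebra.Morphism.Structures using (module RingMorphisms)
open import Data.Empty using (⊥-elim)
open import Data.Fin using (Fin; toℕ)
open import Data.List using (List; []; _∷_; map)
open import Data.Nat using (ℕ; zero; suc; _≤_; _<_; z≤n; NonZero)
import Data.Nat as ℕ
open import Data.Nat.Divisibility using (_∣_; _∣?_; ∣⇒≤; 1∣_)
open import Data.Nat.Properties using (≤-trans; ≤-refl; <⇒≤; ≤-pred; m≤n⇒m<n∨m≡n; m^n>0; +-mono-≤; +-identityʳ)
open import Data.Product using (proj₁; ∃)
open import Data.Sum using (inj₁; inj₂)
open import Function.Bundles using (Bijection)
open import Function.Definitions using (Bijective)
open import Level using (_⊔_) renaming (suc to lsuc)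
open import Relation.Binary.PropositionalEquality using (_≡_; refl; setoid)
open import Relation.Nullary using (¬_; yes; no)

ord₂-upTo : ℕ → ℕ → ℕ
ord₂-upTo n zero    = zero
ord₂-upTo n (suc i) with 2 ℕ.^ suc i ∣? n
... | yes _ = suc i
... | no  _ = ord₂-upTo n i

-- The largest i with 2 ^ i ∣ n, for n positive. It suffices to search i ≤ n,
-- since 2 ^ i ∣ n forces i < 2 ^ i ≤ n; see ord₂-∣ and ord₂-max.
ord₂ : ℕ → ℕ
ord₂ n = ord₂-upTo n n

ord₂-∣ : ∀ n → 2 ℕ.^ ord₂ n ∣ n
ord₂-∣ n = go n
  where
  go : ∀ b → 2 ℕ.^ ord₂-upTo n b ∣ n
  go zero = 1∣ n
  go (suc b) with 2 ℕ.^ suc b ∣? n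
  ... | yes p = p
  ... | no  _ = go b

ord₂-max : ∀ n .{{_ : NonZero n}} i → 2 ℕ.^ i ∣ n → i ≤ ord₂ n
ord₂-max n i 2^i∣n = go n (≤-trans (<⇒≤ (i<2^i i)) (∣⇒≤ 2^i∣n))
  where
  i<2^i : ∀ j → j < 2 ℕ.^ j
  i<2^i zero = ≤-refl
  i<2^i (suc j) rewrite +-identityʳ (2 ℕ.^ j) = +-mono-≤ (m^n>0 2 j) (i<2^i j)

  go : ∀ b → i ≤ b → i ≤ ord₂-upTo n b
  go zero    i≤0 = i≤0
  go (suc b) i≤1+b with 2 ℕ.^ suc b ∣? n
  ... | yes _ = i≤1+b
  ... | no ∤n with m≤n⇒m<n∨m≡n i≤1+b
  ...   | inj₁ i<1+b = go b (≤-pred i<1+b)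
  ...   | inj₂ refl  = ⊥-elim (∤n 2^i∣n)

-- A field in the usual sense: no apartness relation is carried, because the
-- fields of interest are finite, so that their equality is decidable.
record Field c ℓ : Set (lsuc (c ⊔ ℓ)) where
  field
    commutativeRing : CommutativeRing c ℓ

  open CommutativeRing commutativeRing public
  open RawSemiringDefs (Semiring.rawSemiring semiring) public using (_^_; sum)

  field
    1≉0        : ¬ (1# ≈ 0#)
    invertible : ∀ x → ¬ (x ≈ 0#) → ∃ λ y → x * y ≈ 1#

  inv : ∀ x → ¬ (x ≈ 0#) → Carrier
  inv x x≉0 = proj₁ (invertible x x≉0)

HasOrder : ∀ {c ℓ} → Field c ℓ → ℕ → Set (c ⊔ ℓ)
HasOrder F n = Bijection (setoid (Fin n)) (Field.setoid F)

IsFieldEmbedding : ∀ {c₁ ℓ₁ c₂ ℓ₂} (F : Field c₁ ℓ₁) (K : Field c₂ ℓ₂) →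
                   (Field.Carrier F → Field.Carrier K) → Set (c₁ ⊔ ℓ₁ ⊔ ℓ₂)
IsFieldEmbedding F K = IsRingMonomorphism
  where open RingMorphisms (Field.rawRing F) (Field.rawRing K)

-- When F has order r ^ n, with r a prime power, F is an extension of degree n
-- of its subfield 𝔽_r, and this is the trace map from F to 𝔽_r, written as the
-- sum of the conjugates x ^ (r ^ i), 0 ≤ i < n. Its values are kept in F.
Trace : ∀ {c ℓ} (F : Field c ℓ) (r n : ℕ) → Field.Carrier F → Field.Carrier F
Trace F r n x = sum {n} (λ i → x ^ (r ℕ.^ toℕ i))
  where open Field F

-- Univariate polynomials as lists of coefficients, constant term first;
-- trailing zeros are allowed, so a polynomial has several representatives.
module Polynomials {c ℓ} (F : Field c ℓ) where
  open Field F

  infixl 6 _+ₚ_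
  infixl 7 _*ₚ_
  infixr 8 _^ₚ_

  Poly : Set c
  Poly = List Carrier

  con : Carrier → Poly
  con x = x ∷ []

  X : Poly
  X = 0# ∷ 1# ∷ []

  _+ₚ_ : Poly → Poly → Poly
  []      +ₚ q       = q
  (x ∷ p) +ₚ []      = x ∷ p
  (x ∷ p) +ₚ (y ∷ q) = (x + y) ∷ (p +ₚ q)

  _*ₚ_ : Poly → Poly → Poly
  []      *ₚ q = []
  (x ∷ p) *ₚ q = map (x *_) q +ₚ (0# ∷ (p *ₚ q))

  _^ₚ_ : Poly → ℕ → Poly
  p ^ₚ zero  = con 1#
  p ^ₚ suc n = p *ₚ (p ^ₚ n)

  -- Substitution: p ⟨ q ⟩ is the polynomial p(q(X)).
  _⟨_⟩ : Poly → Poly → Poly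
  []      ⟨ q ⟩ = []
  (x ∷ p) ⟨ q ⟩ = con x +ₚ q *ₚ (p ⟨ q ⟩)

  eval : Poly → Carrier → Carrier
  eval []      z = 0#
  eval (x ∷ p) z = x + z * eval p z

  Permutes : Poly → Set (c ⊔ ℓ)
  Permutes p = Bijective _≈_ _≈_ (eval p)

{-# OPTIONS --safe #-}
module Submission where

open import Defs
open import Algebra.Bundles using (CommutativeMonoid; CommutativeRing; RawRing)
open import Algebra.Morphism.Structures using (module RingMorphisms)
import Algebra.Properties.CommutativeMonoid.Sum as MonoidSum
import Algebra.Properties.CommutativeSemigroup as CommutativeSemigroupProperties
import Algebra.Properties.CommutativeSemiring.Exp as Exp
import Algebra.Properties.Ring as RingProperties
import Algebra.Properties.Semiring.Mult as Mult
import Algebra.Properties.Semiring.Sum as SemiringSum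
import Algebra.Solver.Ring as RingSolver
open import Algebra.Solver.Ring.AlmostCommutativeRing using (fromCommutativeRing; _-Raw-AlmostCommutative⟶_; Induced-equivalence)
open import Data.Bool using (Bool; true; false; _xor_; _∧_)
open import Data.Empty using (⊥; ⊥-elim)
open import Data.Fin as Fin using (Fin; zero; suc; toℕ; punchIn; punchOut)
import Data.Fin.Permutation as Perm
import Data.Fin.Properties as Fin
open import Data.List using ([]; _∷_; map)
open import Data.Maybe using (just; nothing)
open import Data.Nat as ℕ using (ℕ; zero; suc; NonZero; _∸_; _%_; _/_; _<_; z≤n; s≤s)
open import Data.Nat.Divisibility as ∣ using (_∣_)
open import Data.Nat.DivMod using (m≡m%n+[m/n]*n; m%n<n; m<n⇒m%n≡m; %-remove-+ʳ; m/n*n≡m)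
open import Data.Nat.GCD using (gcd; gcd-GCD; gcd[m,n]∣m; gcd[m,n]∣n; gcd-greatest; gcd[m,n]≢0; module Bézout)
open import Data.Nat.Properties using (m^n≢0)
import Data.Nat.Properties as ℕ
import Data.Nat.Solver
open import Data.Product using (Σ; _×_; _,_; proj₁; proj₂; ∃)
open import Data.Sum using (_⊎_; inj₁; inj₂; [_,_]′)
open import Data.Vec using (Vec; []; _∷_; replicate)
open import Data.Vec.Functional using (Vector)
open import Function using (_∘_; Congruent; Injective)
open import Function.Bundles using (Bijection; _⇔_; mk⇔)
open import Level using (Level; 0ℓ)
open import Relation.Binary.Definitions using (Decidable; WeaklyDecidable)
open import Relation.Binary.PropositionalEquality as ≡ using (_≡_; _≢_)
import Relation.Binary.Reasoning.Setoid as ≈-Reasoning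
open import Relation.Nullary using (¬_; Dec; yes; no)
open import Relation.Nullary.Decidable using (map′; ¬?; decidable-stable)

-- On z ∈ K = F_{q²} with z̄ = z^q put N(z) = d z^{Q+1} + z^Q z̄ + a z̄^{Q+1}. Up to the substitution x = θ(z), which is
-- bijective because gcd(Q-1, q+1) = 1, and a power of z z̄, the polynomial f is N; hence f permutes K if and only if N
-- maps non-proportional vectors of the F_q-plane K to non-proportional vectors.
--
-- Write E = 1 + a + d, so that e = E², and ε = 1/E, D = d/e, c = 1 + ε = (a+d)/E. Condition (2) says
-- D^Q + D = c² + c. Given (2), a proportionality between N(z) and N(w) amounts to a solution of ζ̄ = ζ + 1, ζ^Q + ζ = c
-- with ζ bilinear in z and w, and conversely such a ζ makes N(ζ) and N(1) proportional. Telescoping the trace shows that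
-- a solution forces Tr(c) = 1 (here l/m is odd); if Tr(c) ≠ 0, a solution is built from a root of ζ² + ζ = D.
--
-- It remains to derive (2) when N separates lines. Take ζ with ζ² + ζ = D. If ζ̄ = ζ + 1, then N(ζ) and N(w) with
-- w^Q = ζ + ε are proportional. If ζ̄ = ζ, an F_q-linear change of coordinates turns N into z (C z^Q + (1 + C) z̄^Q), where C ∈ {0, 1} is
-- condition (2), and Hermite's criterion with exponent q - 1 excludes all other C.

-- The origin of ζ: put L = z w̄ + z̄ w, which vanishes exactly when z and w are proportional over
-- F_q, and A = z w̄ + D (z + z̄)(w + w̄). Up to a nonzero factor, the same determinant of N(z) and
-- N(w) is B L + A L^Q + c L L^Q, where B is A^Q with D^Q replaced by a/e. Condition (2) says
-- precisely that D^Q = a/e. Then B = A^Q, and division by L L^Q gives ζ^Q + ζ = c for ζ = A/L;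
-- since Ā = A + L, also ζ̄ = ζ + 1. The obstacle is the necessity of (2): without it B is not A^Q,
-- and no equation for a single ζ is left. A root of ζ² + ζ = D exists in K because D lies in F_q,
-- and ζ̄ is a root as well, so ζ̄ is ζ or ζ + 1. When the root lies outside F_q, a collision can be
-- written down. When it lies in F_q, none is exhibited: a power sum over all of K shows that one
-- exists.

private variable c ℓ c₁ ℓ₁ : Level

-- Divisibility by r + 1, and the exponent that survives in the power sum

module ℕ-Arithmetic where
  open Data.Nat.Solver.+-*-Solver

  -- `r` is -1 modulo `r + 1`, so even powers are 1. The induction multiplies by
  -- `r * r = 1 + (r - 1)(r + 1)`; the quotient `t` is kept so that no subtraction occurs.
  r^even≡1 : ∀ r .{{_ : NonZero r}} n → ∃ λ t → r ℕ.^ (n ℕ.* 2) ≡ 1 ℕ.+ t ℕ.* suc r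
  r^even≡1 r         zero    = 0 , ≡.refl
  r^even≡1 r@(suc p) (suc n) with r^even≡1 r n
  ... | t , eq = p ℕ.+ r ℕ.* r ℕ.* t , (begin
    r ℕ.* (r ℕ.* r ℕ.^ (n ℕ.* 2))          ≡⟨ ≡.cong (λ x → r ℕ.* (r ℕ.* x)) eq ⟩
    r ℕ.* (r ℕ.* (1 ℕ.+ t ℕ.* suc r))      ≡⟨ solve 3 (λ r t m → r :* (r :* (con 1 :+ t :* m)) := r :* r :+ r :* r :* t :* m) ≡.refl r t (suc r) ⟩
    r ℕ.* r ℕ.+ r ℕ.* r ℕ.* t ℕ.* suc r    ≡⟨ ≡.cong (ℕ._+ r ℕ.* r ℕ.* t ℕ.* suc r) (solve 1 (λ p → (con 1 :+ p) :* (con 1 :+ p) := con 1 :+ p :* (con 2 :+ p)) ≡.refl p) ⟩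
    1 ℕ.+ p ℕ.* suc r ℕ.+ r ℕ.* r ℕ.* t ℕ.* suc r  ≡⟨ ≡.cong suc (≡.sym (ℕ.*-distribʳ-+ (suc r) p (r ℕ.* r ℕ.* t))) ⟩
    1 ℕ.+ (p ℕ.+ r ℕ.* r ℕ.* t) ℕ.* suc r  ∎)
    where open ≡.≡-Reasoning

  1+r∣1+r^odd : ∀ r .{{_ : NonZero r}} n → suc r ∣ 1 ℕ.+ r ℕ.^ suc (n ℕ.* 2)
  1+r∣1+r^odd r n = ∣.divides (1 ℕ.+ r ℕ.* t) (≡.trans (≡.cong (λ x → 1 ℕ.+ r ℕ.* x) (proj₂ (r^even≡1 r n)))
    (solve 2 (λ r t → con 1 :+ r :* (con 1 :+ t :* (con 1 :+ r)) := (con 1 :+ r :* t) :* (con 1 :+ r)) ≡.refl r t))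
    where t = proj₁ (r^even≡1 r n)

  -- Both `x` and `y` are congruent to `-z`; naming the complement `z` expresses this without
  -- negative numbers.
  ∣⇒≡-%-≤ : ∀ m .{{_ : NonZero m}} {x y z} → x ℕ.≤ y → m ∣ x ℕ.+ z → m ∣ y ℕ.+ z → x % m ≡ y % m
  ∣⇒≡-%-≤ m {x} {y} {z} x≤y m∣x+z m∣y+z = ≡.trans (≡.sym (%-remove-+ʳ x m∣y∸x)) (≡.cong (_% m) (ℕ.m+[n∸m]≡n x≤y))
    where
    m∣y∸x : m ∣ y ∸ x
    m∣y∸x = ∣.∣m+n∣m⇒∣n (≡.subst (m ∣_) (≡.trans (≡.cong (ℕ._+ z) (≡.sym (ℕ.m+[n∸m]≡n x≤y)))
      (solve 3 (λ x d z → x :+ d :+ z := x :+ z :+ d) ≡.refl x (y ∸ x) z)) m∣y+z) m∣x+z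

  ∣⇒≡-% : ∀ m .{{_ : NonZero m}} {x y z} → m ∣ x ℕ.+ z → m ∣ y ℕ.+ z → x % m ≡ y % m
  ∣⇒≡-% m {x} {y} m∣x+z m∣y+z with ℕ.≤-total x y
  ... | inj₁ x≤y = ∣⇒≡-%-≤ m x≤y m∣x+z m∣y+z
  ... | inj₂ y≤x = ≡.sym (∣⇒≡-%-≤ m y≤x m∣y+z m∣x+z)

  1+[q∸1]r<q*q : ∀ q r → 2 ℕ.≤ q → r ℕ.≤ q → 1 ℕ.+ (q ∸ 1) ℕ.* r < q ℕ.* q
  1+[q∸1]r<q*q q@(suc p) r 2≤q r≤q = ℕ.≤-<-trans (ℕ.+-monoʳ-≤ 1 (ℕ.*-monoʳ-≤ p r≤q)) (ℕ.+-monoˡ-< (p ℕ.* q) 2≤q)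

  -- The numbers `1 + Q s` with `1 ≤ s ≤ q` become, times `q - 1`, the exponents of a power-sum
  -- expansion; the one divisible by `q + 1` gives its only surviving term.
  UniqueRoot : ℕ → ℕ → Set
  UniqueRoot q Q = ∃ λ (i : Fin q) → suc q ∣ 1 ℕ.+ Q ℕ.* suc (toℕ i) ×
                   (∀ (i′ : Fin q) → suc q ∣ 1 ℕ.+ Q ℕ.* suc (toℕ i′) → i′ ≡ i)

  module _ {q Q j : ℕ} (1≤q : 1 ℕ.≤ q) (q+1∣1+Qj : suc q ∣ 1 ℕ.+ Q ℕ.* j) where
    private
      q+1∣1+Q[j%m] : suc q ∣ 1 ℕ.+ Q ℕ.* (j % suc q)
      q+1∣1+Q[j%m] = ∣.∣m+n∣m⇒∣n (≡.subst (suc q ∣_)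
        (≡.trans (≡.cong (λ j → 1 ℕ.+ Q ℕ.* j) (m≡m%n+[m/n]*n j (suc q)))
          (solve 4 (λ Q r t m → con 1 :+ Q :* (r :+ t :* m) := Q :* t :* m :+ (con 1 :+ Q :* r)) ≡.refl Q (j % suc q) (j / suc q) (suc q))) q+1∣1+Qj)
        (∣.n∣m*n (Q ℕ.* (j / suc q)))

    -- The root is `j` reduced modulo `q + 1`; remainder 0 would make `q + 1` divide 1.
    unique-root : UniqueRoot q Q
    unique-root = at (j % suc q) ≡.refl (m%n<n j (suc q)) q+1∣1+Q[j%m]
      where
      at : ∀ r → j % suc q ≡ r → r < suc q → suc q ∣ 1 ℕ.+ Q ℕ.* r → UniqueRoot q Q
      at zero    eq _         q+1∣ = ⊥-elim (ℕ.1+n≰n (ℕ.≤-trans (s≤s 1≤q)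
        (ℕ.≤-reflexive (∣.∣1⇒≡1 (≡.subst (λ x → suc q ∣ 1 ℕ.+ x) (ℕ.*-zeroʳ Q) q+1∣)))))
      at (suc i) eq (s≤s i<q) q+1∣ = Fin.fromℕ< i<q ,
        ≡.subst (λ x → suc q ∣ 1 ℕ.+ Q ℕ.* suc x) (≡.sym (Fin.toℕ-fromℕ< i<q)) q+1∣ , unique
        where
        unique : ∀ (i′ : Fin q) → suc q ∣ 1 ℕ.+ Q ℕ.* suc (toℕ i′) → i′ ≡ Fin.fromℕ< i<q
        -- Both `s = suc (toℕ i′)` and `j` have the complement `Q j s`: the sums are the multiples
        -- `s (1 + Q j)` and `j (1 + Q s)`.
        unique i′ q+1∣i′ = Fin.toℕ-injective (≡.trans (ℕ.suc-injective (≡.trans (≡.sym (m<n⇒m%n≡m (s≤s (Fin.toℕ<n i′))))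
          (≡.trans (∣⇒≡-% (suc q) {suc (toℕ i′)} {j} {Q ℕ.* j ℕ.* suc (toℕ i′)}
            (∣.∣m⇒∣m*n (suc (toℕ i′)) q+1∣1+Qj)
            (≡.subst (suc q ∣_) (solve 3 (λ j Q s → j :* (con 1 :+ Q :* s) := j :+ Q :* j :* s) ≡.refl j Q (suc (toℕ i′))) (∣.∣n⇒∣m*n j q+1∣i′)))
            eq))) (≡.sym (Fin.toℕ-fromℕ< i<q)))

  -- `Q j` is the odd power `q ^ (2l + 1)`, which is -1 modulo `q + 1`. An exponent as large as
  -- `2l + 1` makes `Q` divide this power of 2.
  q+1∣1+Qj : ∀ k l .{{_ : NonZero k}} → suc (2 ℕ.^ k) ∣ 1 ℕ.+ 2 ℕ.^ l ℕ.* 2 ℕ.^ (k ℕ.* suc (l ℕ.* 2) ∸ l)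
  q+1∣1+Qj k l = ≡.subst (λ x → suc (2 ℕ.^ k) ∣ 1 ℕ.+ x) (begin
    (2 ℕ.^ k) ℕ.^ suc (l ℕ.* 2)                        ≡⟨ ℕ.^-*-assoc 2 k _ ⟩
    2 ℕ.^ (k ℕ.* suc (l ℕ.* 2))                        ≡⟨ ≡.cong (2 ℕ.^_) (ℕ.m+[n∸m]≡n l≤) ⟨
    2 ℕ.^ (l ℕ.+ (k ℕ.* suc (l ℕ.* 2) ∸ l))            ≡⟨ ℕ.^-distribˡ-+-* 2 l _ ⟩
    2 ℕ.^ l ℕ.* 2 ℕ.^ (k ℕ.* suc (l ℕ.* 2) ∸ l)        ∎)
    (1+r∣1+r^odd (2 ℕ.^ k) {{ℕ.m^n≢0 2 k}} l)
    where
    open ≡.≡-Reasoning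
    l≤ : l ℕ.≤ k ℕ.* suc (l ℕ.* 2)
    l≤ = ℕ.≤-trans (ℕ.m≤m*n l 2) (ℕ.≤-trans (ℕ.n≤1+n _) (ℕ.m≤n*m _ k))

-- Finite sets, finite sums and elementary field arithmetic

injective⇒surjective : ∀ {n} (f : Fin n → Fin n) → Injective _≡_ _≡_ f → ∀ j → ∃ λ i → f i ≡ j
injective⇒surjective {suc n} f f-injective j with Fin.any? (λ i → f i Fin.≟ j)
... | yes hit = hit
... | no miss = ⊥-elim (ℕ.1+n≰n (Fin.injective⇒≤ {f = g} g-injective))
  where
  j≢f : ∀ i → j ≢ f i
  j≢f i eq = miss (i , ≡.sym eq)
  g : Fin (suc n) → Fin n
  g i = punchOut (j≢f i)
  g-injective : Injective _≡_ _≡_ g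
  g-injective eq = f-injective (Fin.punchOut-injective (j≢f _) (j≢f _) eq)

module _ (M : CommutativeMonoid c₁ ℓ₁) where
  open CommutativeMonoid M
  open MonoidSum M using (sum; sum-remove; sum-cong-≋; sum-replicate-zero)

  sum-supported-at : ∀ {n} (t : Vector Carrier n) i → (∀ j → j ≢ i → t j ≈ ε) → sum t ≈ t i
  sum-supported-at {suc n} t i t≈ε = trans (sum-remove {i = i} t)
    (trans (∙-congˡ (trans (sum-cong-≋ (λ j → t≈ε (punchIn i j) (Fin.punchInᵢ≢i i j))) (sum-replicate-zero n)))
           (identityʳ (t i)))

module FieldProperties (F : Field c ℓ) where
  open Field F hiding (zero)
  open Exp commutativeSemiring hiding (_^_)

  *-cancelˡ-0 : ∀ {x y} → ¬ (x ≈ 0#) → x * y ≈ 0# → y ≈ 0#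
  *-cancelˡ-0 {x} {y} x≉0 xy≈0 with invertible x x≉0
  ... | x⁻¹ , xx⁻¹≈1 = begin
    y              ≈⟨ *-identityˡ y ⟨
    1# * y         ≈⟨ *-congʳ (trans (*-comm x⁻¹ x) xx⁻¹≈1) ⟨
    x⁻¹ * x * y    ≈⟨ *-assoc x⁻¹ x y ⟩
    x⁻¹ * (x * y)  ≈⟨ *-congˡ xy≈0 ⟩
    x⁻¹ * 0#       ≈⟨ zeroʳ x⁻¹ ⟩
    0#             ∎
    where open ≈-Reasoning setoid

  *-≉0 : ∀ {x y} → ¬ (x ≈ 0#) → ¬ (y ≈ 0#) → ¬ (x * y ≈ 0#)
  *-≉0 x≉0 y≉0 xy≈0 = y≉0 (*-cancelˡ-0 x≉0 xy≈0)

  *-cancelˡ-≉0 : ∀ {x y z} → ¬ (x ≈ 0#) → x * y ≈ x * z → y ≈ z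
  *-cancelˡ-≉0 {x} {y} {z} x≉0 xy≈xz = begin
    y             ≈⟨ *-identityˡ y ⟨
    1# * y        ≈⟨ *-congʳ x⁻¹x≈1 ⟨
    x⁻¹ * x * y   ≈⟨ *-assoc x⁻¹ x y ⟩
    x⁻¹ * (x * y) ≈⟨ *-congˡ xy≈xz ⟩
    x⁻¹ * (x * z) ≈⟨ *-assoc x⁻¹ x z ⟨
    x⁻¹ * x * z   ≈⟨ *-congʳ x⁻¹x≈1 ⟩
    1# * z        ≈⟨ *-identityˡ z ⟩
    z             ∎
    where
    open ≈-Reasoning setoid
    x⁻¹ = inv x x≉0
    x⁻¹x≈1 : x⁻¹ * x ≈ 1#
    x⁻¹x≈1 = trans (*-comm x⁻¹ x) (proj₂ (invertible x x≉0))

  inverse-≉0 : ∀ {x y} → x * y ≈ 1# → ¬ (y ≈ 0#)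
  inverse-≉0 xy≈1 y≈0 = 1≉0 (trans (sym xy≈1) (trans (*-congˡ y≈0) (zeroʳ _)))

  ^-≉0 : ∀ {x} n → ¬ (x ≈ 0#) → ¬ (x ^ n ≈ 0#)
  ^-≉0 zero    x≉0 = 1≉0
  ^-≉0 (suc n) x≉0 = *-≉0 x≉0 (^-≉0 n x≉0)

  1^n≈1 : ∀ n → 1# ^ n ≈ 1#
  1^n≈1 zero    = refl
  1^n≈1 (suc n) = trans (*-identityˡ _) (1^n≈1 n)

  0^n≈0 : ∀ n .{{_ : NonZero n}} → 0# ^ n ≈ 0#
  0^n≈0 (suc n) = zeroˡ _

-- Finite fields: reindexing by permutations, and x^n = x

module FiniteField (F : Field c ℓ) {n : ℕ} (enumeration : HasOrder F n) where
  open Field F hiding (zero)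
  open FieldProperties F
  open Bijection enumeration using (to; injective; surjective)

  index : Carrier → Fin n
  index x = proj₁ (surjective x)

  to-index : ∀ x → to (index x) ≈ x
  to-index x = proj₂ (surjective x) ≡.refl

  index-cong : ∀ {x y} → x ≈ y → index x ≡ index y
  index-cong x≈y = injective (trans (to-index _) (trans x≈y (sym (to-index _))))

  index-injective : ∀ {x y} → index x ≡ index y → x ≈ y
  index-injective {x} {y} eq = trans (sym (to-index x)) (trans (reflexive (≡.cong to eq)) (to-index y))

  infix 4 _≟_
  _≟_ : Decidable _≈_
  x ≟ y = map′ index-injective index-cong (index x Fin.≟ index y)

  module _ {f : Carrier → Carrier} (f-cong : Congruent _≈_ _≈_ f) (f-injective : Injective _≈_ _≈_ f) where
    private
      g : Fin n → Fin n
      g i = index (f (to i))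

      g-injective : Injective _≡_ _≡_ g
      g-injective eq = injective (f-injective (index-injective eq))

      g-surjective : ∀ j → ∃ λ i → g i ≡ j
      g-surjective = injective⇒surjective g g-injective

      π : Perm.Permutation′ n
      π = Perm.permutation g (proj₁ ∘ g-surjective) (proj₂ ∘ g-surjective)
            (λ i → g-injective (proj₂ (g-surjective (g i))))

    injective⇒preimage : ∀ y → ∃ λ x → f x ≈ y
    injective⇒preimage y with g-surjective (index y)
    ... | i , eq = to i , index-injective eq

    -- Stated over an arbitrary commutative monoid: `x ^ n = x` needs the product over the field,
    -- power sums need the sum.
    sum-reindex : (M : CommutativeMonoid c₁ ℓ₁) (let open CommutativeMonoid M using () renaming (_≈_ to _∼_)) →
                  {h : Carrier → CommutativeMonoid.Carrier M} → (∀ {x y} → x ≈ y → h x ∼ h y) →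
                  MonoidSum.sum M (λ i → h (f (to i))) ∼ MonoidSum.sum M (λ i → h (to i))
    sum-reindex M {h} h-cong = M.sym (M.trans (sum-permute (h ∘ to) π) (sum-cong-≋ (λ i → h-cong (to-index (f (to i))))))
      where
      module M = CommutativeMonoid M
      open MonoidSum M using (sum-permute; sum-cong-≋)

  ∑ : (Carrier → Carrier) → Carrier
  ∑ h = sum (h ∘ to)

  open SemiringSum semiring using (∑-distrib-+; sum-replicate; *-distribˡ-sum; sum-cong-≋)
  open Mult semiring using () renaming (_×_ to _·_)

  -- Adding 1 permutes the field, so the sum of all elements equals itself plus `n · 1`.
  order·1≈0 : n · 1# ≈ 0#
  order·1≈0 = +-identityˡ-unique (∑ (λ x → x)) (begin
    n · 1# + ∑ (λ x → x)        ≈⟨ +-congʳ (sum-replicate n) ⟨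
    ∑ (λ _ → 1#) + ∑ (λ x → x)  ≈⟨ ∑-distrib-+ (λ _ → 1#) to ⟨
    ∑ (λ x → 1# + x)            ≈⟨ sum-reindex +-congˡ (+-cancelˡ 1# _ _) +-commutativeMonoid (λ eq → eq) ⟩
    ∑ (λ x → x)                 ∎)
    where
    open ≈-Reasoning setoid
    open RingProperties ring using (+-cancelˡ)
    +-identityˡ-unique : ∀ x {y} → y + x ≈ x → y ≈ 0#
    +-identityˡ-unique x eq = +-cancelˡ x _ _ (trans (+-comm x _) (trans eq (sym (+-identityʳ x))))

  -- Multiplication by x permutes the nonzero elements; u and w extend the product over them by harmless factors at 0.
  x^order≈x-≉0 : ∀ x → ¬ (x ≈ 0#) → x ^ n ≈ x
  x^order≈x-≉0 x x≉0 = *-cancelˡ-≉0 (Π≉0 (u ∘ to) (u≉0 ∘ to)) (begin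
    Π (u ∘ to) * x ^ n                   ≈⟨ *-comm _ _ ⟩
    x ^ n * Π (u ∘ to)                   ≈⟨ *-congʳ (Product.sum-replicate n) ⟨
    Π {n} (λ _ → x) * Π (u ∘ to)             ≈⟨ Product.∑-distrib-+ (λ _ → x) (u ∘ to) ⟨
    Π (λ i → x * u (to i))               ≈⟨ Product.sum-cong-≋ (λ i → w*u (to i)) ⟨
    Π (λ i → w (to i) * u (x * to i))    ≈⟨ Product.∑-distrib-+ (w ∘ to) (λ i → u (x * to i)) ⟩
    Π (w ∘ to) * Π (λ i → u (x * to i))  ≈⟨ *-cong Πw≈x (sum-reindex *-congˡ (*-cancelˡ-≉0 x≉0) *-commutativeMonoid u-cong) ⟩
    x * Π (u ∘ to)                       ≈⟨ *-comm _ _ ⟩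
    Π (u ∘ to) * x                       ∎)
    where
    open ≈-Reasoning setoid
    module Product = MonoidSum *-commutativeMonoid
    Π : ∀ {m} → Vector Carrier m → Carrier
    Π = Product.sum

    Π≉0 : ∀ {m} (t : Vector Carrier m) → (∀ i → ¬ (t i ≈ 0#)) → ¬ (Π t ≈ 0#)
    Π≉0 {zero}  t t≉0 = 1≉0
    Π≉0 {suc m} t t≉0 = *-≉0 (t≉0 zero) (Π≉0 (t ∘ suc) (t≉0 ∘ suc))

    u w : Carrier → Carrier
    u y with y ≟ 0#
    ... | yes _ = 1#
    ... | no _  = y
    w y with y ≟ 0#
    ... | yes _ = x
    ... | no _  = 1#

    u≉0 : ∀ y → ¬ (u y ≈ 0#)
    u≉0 y with y ≟ 0#
    ... | yes _  = 1≉0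
    ... | no y≉0 = y≉0

    u-cong : ∀ {y z} → y ≈ z → u y ≈ u z
    u-cong {y} {z} y≈z with y ≟ 0# | z ≟ 0#
    ... | yes _   | yes _   = refl
    ... | yes y≈0 | no z≉0  = ⊥-elim (z≉0 (trans (sym y≈z) y≈0))
    ... | no y≉0  | yes z≈0 = ⊥-elim (y≉0 (trans y≈z z≈0))
    ... | no _    | no _    = y≈z

    w*u : ∀ y → w y * u (x * y) ≈ x * u y
    w*u y with y ≟ 0# | x * y ≟ 0#
    ... | yes _   | yes _    = refl
    ... | yes y≈0 | no xy≉0  = ⊥-elim (xy≉0 (trans (*-congˡ y≈0) (zeroʳ x)))
    ... | no y≉0  | yes xy≈0 = ⊥-elim (*-≉0 x≉0 y≉0 xy≈0)
    ... | no _    | no _     = *-identityˡ (x * y)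

    w-nonzero : ∀ {y} → ¬ (y ≈ 0#) → w y ≈ 1#
    w-nonzero {y} y≉0 with y ≟ 0#
    ... | yes y≈0 = ⊥-elim (y≉0 y≈0)
    ... | no _    = refl

    w-zero : ∀ {y} → y ≈ 0# → w y ≈ x
    w-zero {y} y≈0 with y ≟ 0#
    ... | yes _  = refl
    ... | no y≉0 = ⊥-elim (y≉0 y≈0)

    Πw≈x : Π (w ∘ to) ≈ x
    Πw≈x = trans (sum-supported-at *-commutativeMonoid (w ∘ to) (index 0#)
      (λ j j≢ → w-nonzero (λ toj≈0 → j≢ (injective (trans toj≈0 (sym (to-index 0#)))))))
      (w-zero (to-index 0#))

  x^order≈x : .{{_ : NonZero n}} → ∀ x → x ^ n ≈ x
  x^order≈x x with x ≟ 0#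
  ... | no x≉0  = x^order≈x-≉0 x x≉0
  ... | yes x≈0 = trans (Exp.^-congˡ commutativeSemiring n x≈0) (trans (0^n≈0 n) (sym x≈0))

-- Solving ring identities in characteristic 2

𝔽₂ : RawRing 0ℓ 0ℓ
𝔽₂ = record { Carrier = Bool ; _≈_ = _≡_ ; _+_ = _xor_ ; _*_ = _∧_ ; -_ = λ b → b ; 0# = false ; 1# = true }

HasCharacteristic2 : CommutativeRing c ℓ → Set ℓ
HasCharacteristic2 R = 1# + 1# ≈ 0#
  where open CommutativeRing R

-- Coefficients are computed in `𝔽₂`, so the solver also proves identities that hold only because
-- terms occurring twice cancel and signs disappear.
module Char2Solver (R : CommutativeRing c ℓ) (1+1≈0 : HasCharacteristic2 R) where
  open CommutativeRing R

  ⟦_⟧₂ : Bool → Carrier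
  ⟦ false ⟧₂ = 0#
  ⟦ true ⟧₂  = 1#

  𝔽₂⟶R : 𝔽₂ -Raw-AlmostCommutative⟶ fromCommutativeRing R
  𝔽₂⟶R = record
    { ⟦_⟧    = ⟦_⟧₂
    ; +-homo = λ { false y → sym (+-identityˡ _) ; true false → sym (+-identityʳ _) ; true true → sym 1+1≈0 }
    ; *-homo = λ { false y → sym (zeroˡ _) ; true y → sym (*-identityˡ _) }
    ; -‿homo = λ { false → +-inverseʳ-unique 0# 0# (+-identityˡ 0#) ; true → +-inverseʳ-unique 1# 1# 1+1≈0 }
    ; 0-homo = refl
    ; 1-homo = refl
    }
    where open RingProperties ring using (+-inverseʳ-unique)

  _≟₂_ : WeaklyDecidable (Induced-equivalence 𝔽₂⟶R)
  false ≟₂ false = just refl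
  true  ≟₂ true  = just refl
  _     ≟₂ _     = nothing

  open RingSolver 𝔽₂ (fromCommutativeRing R) 𝔽₂⟶R _≟₂_ public using (solve; con; _:+_; _:*_; _:=_; _:^_)

  :1 : ∀ {n} → RingSolver.Polynomial 𝔽₂ (fromCommutativeRing R) 𝔽₂⟶R _≟₂_ n
  :1 = con true

-- Frobenius powers, partial traces and root counting

module Char2Field (F : Field c ℓ) (1+1≈0 : HasCharacteristic2 (Field.commutativeRing F)) where
  open Field F hiding (zero)
  open FieldProperties F
  open Exp commutativeSemiring hiding (_^_)
  open Char2Solver commutativeRing 1+1≈0 public
  open ≈-Reasoning setoid

  x+x≈0 : ∀ x → x + x ≈ 0#
  x+x≈0 = solve 1 (λ x → x :+ x := con false) refl

  x+y≈0⇒x≈y : ∀ {x y} → x + y ≈ 0# → x ≈ y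
  x+y≈0⇒x≈y {x} {y} x+y≈0 = begin
    x            ≈⟨ solve 2 (λ x y → x := (x :+ y) :+ y) refl x y ⟩
    x + y + y    ≈⟨ +-congʳ x+y≈0 ⟩
    0# + y       ≈⟨ +-identityˡ y ⟩
    y            ∎

  x≈y⇒x+y≈0 : ∀ {x y} → x ≈ y → x + y ≈ 0#
  x≈y⇒x+y≈0 {x} {y} x≈y = trans (+-congʳ x≈y) (x+x≈0 y)

  frob : ℕ → Carrier → Carrier
  frob j x = x ^ (2 ℕ.^ j)

  frob-cong : ∀ j {x y} → x ≈ y → frob j x ≈ frob j y
  frob-cong j = ^-congˡ (2 ℕ.^ j)

  frob-+ : ∀ j x y → frob j (x + y) ≈ frob j x + frob j y
  frob-+ zero    x y = solve 2 (λ x y → (x :+ y) :* :1 := x :* :1 :+ y :* :1) refl x y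
  frob-+ (suc j) x y = begin
    frob (suc j) (x + y)              ≈⟨ ^-assocʳ (x + y) 2 (2 ℕ.^ j) ⟨
    frob j ((x + y) ^ 2)              ≈⟨ frob-cong j (solve 2 (λ x y → (x :+ y) :^ 2 := x :^ 2 :+ y :^ 2) refl x y) ⟩
    frob j (x ^ 2 + y ^ 2)            ≈⟨ frob-+ j (x ^ 2) (y ^ 2) ⟩
    frob j (x ^ 2) + frob j (y ^ 2)   ≈⟨ +-cong (^-assocʳ x 2 (2 ℕ.^ j)) (^-assocʳ y 2 (2 ℕ.^ j)) ⟩
    frob (suc j) x + frob (suc j) y   ∎

  frob-* : ∀ j x y → frob j (x * y) ≈ frob j x * frob j y
  frob-* j x y = ^-distrib-* x y (2 ℕ.^ j)

  frob-1 : ∀ j → frob j 1# ≈ 1#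
  frob-1 j = 1^n≈1 (2 ℕ.^ j)

  frob-^ : ∀ j x n → frob j (x ^ n) ≈ frob j x ^ n
  frob-^ j x n = begin
    (x ^ n) ^ (2 ℕ.^ j)   ≈⟨ ^-assocʳ x n (2 ℕ.^ j) ⟩
    x ^ (n ℕ.* 2 ℕ.^ j)   ≈⟨ ^-congʳ x (ℕ.*-comm n (2 ℕ.^ j)) ⟩
    x ^ (2 ℕ.^ j ℕ.* n)   ≈⟨ ^-assocʳ x (2 ℕ.^ j) n ⟨
    (x ^ (2 ℕ.^ j)) ^ n   ∎

  frob-comm : ∀ i j x → frob i (frob j x) ≈ frob j (frob i x)
  frob-comm i j x = frob-^ i x (2 ℕ.^ j)

  frob-∘ : ∀ i j x → frob i (frob j x) ≈ frob (j ℕ.+ i) x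
  frob-∘ i j x = trans (^-assocʳ x (2 ℕ.^ j) (2 ℕ.^ i)) (^-congʳ x (≡.sym (ℕ.^-distribˡ-+-* 2 j i)))

  frob-≉0 : ∀ j {x} → ¬ (x ≈ 0#) → ¬ (frob j x ≈ 0#)
  frob-≉0 j = ^-≉0 (2 ℕ.^ j)

  Fixed : ℕ → Carrier → Set ℓ
  Fixed j x = frob j x ≈ x

  fixed-+ : ∀ j {x y} → Fixed j x → Fixed j y → Fixed j (x + y)
  fixed-+ j fx fy = trans (frob-+ j _ _) (+-cong fx fy)

  fixed-* : ∀ j {x y} → Fixed j x → Fixed j y → Fixed j (x * y)
  fixed-* j fx fy = trans (frob-* j _ _) (*-cong fx fy)

  fixed-frob : ∀ j {x} i → Fixed j x → Fixed j (frob i x)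
  fixed-frob j {x} i fx = trans (frob-comm j i x) (frob-cong i fx)

  fixed-inverse : ∀ j {x y} → x * y ≈ 1# → Fixed j x → Fixed j y
  fixed-inverse j {x} {y} xy≈1 fx = *-cancelˡ-≉0 (inverse-≉0 (trans (*-comm y x) xy≈1)) (begin
    x * frob j y         ≈⟨ *-congʳ fx ⟨
    frob j x * frob j y  ≈⟨ frob-* j x y ⟨
    frob j (x * y)       ≈⟨ frob-cong j xy≈1 ⟩
    frob j 1#            ≈⟨ frob-1 j ⟩
    1#                   ≈⟨ xy≈1 ⟨
    x * y                ∎)

  idempotent⇒fixed : ∀ j {x} → x * x ≈ x → Fixed j x
  idempotent⇒fixed zero    {x} xx≈x = *-identityʳ x
  idempotent⇒fixed (suc j) {x} xx≈x = begin
    frob (suc j) x       ≈⟨ frob-∘ j 1 x ⟨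
    frob j (x * (x * 1#))    ≈⟨ frob-cong j (trans (*-congˡ (*-identityʳ x)) xx≈x) ⟩
    frob j x             ≈⟨ idempotent⇒fixed j xx≈x ⟩
    x                    ∎

  idempotent⇒0∨1 : ∀ {x} → Dec (x ≈ 0#) → x * x ≈ x → x ≈ 0# ⊎ x ≈ 1#
  idempotent⇒0∨1 (yes x≈0) xx≈x = inj₁ x≈0
  idempotent⇒0∨1 (no x≉0)  xx≈x = inj₂ (*-cancelˡ-≉0 x≉0 (trans xx≈x (sym (*-identityʳ _))))

  -- The trace in nested (Horner) form. The length `n` is arbitrary, so this is a partial sum of
  -- conjugates, as telescoping and iteration require.
  tr : ℕ → ℕ → Carrier → Carrier
  tr i zero    x = 0#
  tr i (suc n) x = x + frob i (tr i n x)

  tr-cong : ∀ i n {x y} → x ≈ y → tr i n x ≈ tr i n y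
  tr-cong i zero    x≈y = refl
  tr-cong i (suc n) x≈y = +-cong x≈y (frob-cong i (tr-cong i n x≈y))

  tr-+ : ∀ i n x y → tr i n (x + y) ≈ tr i n x + tr i n y
  tr-+ i zero    x y = sym (+-identityˡ 0#)
  tr-+ i (suc n) x y = begin
    x + y + frob i (tr i n (x + y))                     ≈⟨ +-congˡ (frob-cong i (tr-+ i n x y)) ⟩
    x + y + frob i (tr i n x + tr i n y)                ≈⟨ +-congˡ (frob-+ i _ _) ⟩
    x + y + (frob i (tr i n x) + frob i (tr i n y))     ≈⟨ solve 4 (λ x y s t → x :+ y :+ (s :+ t) := x :+ s :+ (y :+ t)) refl _ _ _ _ ⟩
    x + frob i (tr i n x) + (y + frob i (tr i n y))     ∎

  tr-frob : ∀ i n j x → tr i n (frob j x) ≈ frob j (tr i n x)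
  tr-frob i zero    j x = sym (0^n≈0 (2 ℕ.^ j) {{ℕ.m^n≢0 2 j}})
  tr-frob i (suc n) j x = begin
    frob j x + frob i (tr i n (frob j x))  ≈⟨ +-congˡ (frob-cong i (tr-frob i n j x)) ⟩
    frob j x + frob i (frob j (tr i n x))  ≈⟨ +-congˡ (frob-comm i j _) ⟩
    frob j x + frob j (frob i (tr i n x))  ≈⟨ frob-+ j _ _ ⟨
    frob j (x + frob i (tr i n x))         ∎

  tr-scale : ∀ i n {s} x → Fixed i s → tr i n (s * x) ≈ s * tr i n x
  tr-scale i zero    {s} x fs = sym (zeroʳ s)
  tr-scale i (suc n) {s} x fs = begin
    s * x + frob i (tr i n (s * x))        ≈⟨ +-congˡ (frob-cong i (tr-scale i n x fs)) ⟩
    s * x + frob i (s * tr i n x)          ≈⟨ +-congˡ (trans (frob-* i s _) (*-congʳ fs)) ⟩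
    s * x + s * frob i (tr i n x)          ≈⟨ distribˡ s _ _ ⟨
    s * (x + frob i (tr i n x))            ∎

  -- All inner conjugates occur twice. When `frob (n ℕ.* i)` fixes `x`, this makes the trace
  -- invariant under `frob i`.
  tr-telescope : ∀ i n x → frob i (tr i n x) + tr i n x ≈ frob (n ℕ.* i) x + x
  tr-telescope i zero    x = begin
    frob i 0# + 0#  ≈⟨ +-congʳ (0^n≈0 (2 ℕ.^ i) {{ℕ.m^n≢0 2 i}}) ⟩
    0# + 0#         ≈⟨ solve 1 (λ x → con false :+ con false := x :* :1 :+ x) refl x ⟩
    frob 0 x + x    ∎
  tr-telescope i (suc n) x = begin
    frob i (x + frob i t) + (x + frob i t)      ≈⟨ solve 3 (λ y x s → y :+ (x :+ s) := (y :+ s) :+ x) refl _ _ _ ⟩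
    frob i (x + frob i t) + frob i t + x        ≈⟨ +-congʳ (sym (frob-+ i _ _)) ⟩
    frob i (x + frob i t + t) + x               ≈⟨ +-congʳ (frob-cong i (trans (+-assoc _ _ _) (+-congˡ (tr-telescope i n x)))) ⟩
    frob i (x + (frob (n ℕ.* i) x + x)) + x     ≈⟨ +-congʳ (frob-cong i (solve 2 (λ x y → x :+ (y :+ x) := y) refl _ _)) ⟩
    frob i (frob (n ℕ.* i) x) + x               ≈⟨ +-congʳ (trans (frob-∘ i (n ℕ.* i) x) (^-congʳ x (≡.cong (2 ℕ.^_) (ℕ.+-comm (n ℕ.* i) i)))) ⟩
    frob (suc n ℕ.* i) x + x                    ∎
    where t = tr i n x

  -- Each further application of `frob i` adds a conjugate of `s`, so the displacement after `n`
  -- steps is a partial trace of `s`.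
  frob-iterate : ∀ i n {x s} → frob i x ≈ x + s → frob (n ℕ.* i) x ≈ x + tr i n s
  frob-iterate i zero    {x} φx = solve 1 (λ x → x :* :1 := x :+ con false) refl x
  frob-iterate i (suc n) {x} {s} φx = begin
    frob (suc n ℕ.* i) x            ≈⟨ trans (frob-∘ i (n ℕ.* i) x) (^-congʳ x (≡.cong (2 ℕ.^_) (ℕ.+-comm (n ℕ.* i) i))) ⟨
    frob i (frob (n ℕ.* i) x)       ≈⟨ frob-cong i (frob-iterate i n φx) ⟩
    frob i (x + tr i n s)           ≈⟨ frob-+ i _ _ ⟩
    frob i x + frob i (tr i n s)    ≈⟨ +-congʳ φx ⟩
    x + s + frob i (tr i n s)       ≈⟨ +-assoc _ _ _ ⟩
    x + tr i (suc n) s              ∎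

  -- The conjugates of `s` all equal `s`, and an odd number of them is summed in characteristic 2.
  tr-odd : ∀ i n {s} → Fixed i s → tr i (suc (n ℕ.* 2)) s ≈ s
  tr-odd i zero    {s} fs = trans (+-congˡ (0^n≈0 (2 ℕ.^ i) {{ℕ.m^n≢0 2 i}})) (+-identityʳ s)
  tr-odd i (suc n) {s} fs = begin
    s + frob i (s + frob i (tr i (suc (n ℕ.* 2)) s))  ≈⟨ +-congˡ (frob-cong i (+-congˡ (trans (frob-cong i (tr-odd i n fs)) fs))) ⟩
    s + frob i (s + s)                                 ≈⟨ +-congˡ (frob-+ i s s) ⟩
    s + (frob i s + frob i s)                          ≈⟨ solve 2 (λ s t → s :+ (t :+ t) := s) refl s _ ⟩
    s                                                  ∎

  -- The vector p lists the lower coefficients of a monic polynomial of degree n.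
  value : ∀ {n} → Vec Carrier n → Carrier → Carrier
  value []      x = 1#
  value (c ∷ p) x = c + x * value p x

  -- Adds `r` times a monic polynomial of degree `n` to one of degree `n + 1`, so the sum stays
  -- monic. In the base case `r` comes from the leading coefficient 1 that the vector omits.
  _⊞_·_ : ∀ {n} → Vec Carrier (suc n) → Carrier → Vec Carrier n → Vec Carrier (suc n)
  (c ∷ p) ⊞ r · []      = (c + r) ∷ p
  (c ∷ p) ⊞ r · (b ∷ q) = (c + r * b) ∷ (p ⊞ r · q)

  -- Synthetic division by `X + r`: for `p = c + X p'`, the difference `p + p(r)` is
  -- `(X + r) p' + r (p' + p'(r))`.
  quotient : ∀ {n} → Vec Carrier (suc n) → Carrier → Vec Carrier n
  quotient (c ∷ [])      r = []
  quotient (c ∷ p@(_ ∷ _)) r = p ⊞ r · quotient p r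

  value-⊞ : ∀ {n} (p : Vec Carrier (suc n)) r (q : Vec Carrier n) x → value (p ⊞ r · q) x ≈ value p x + r * value q x
  value-⊞ (c ∷ p) r []      x = solve 3 (λ c r y → c :+ r :+ y := c :+ y :+ r :* :1) refl c r _
  value-⊞ (c ∷ p) r (b ∷ q) x = begin
    c + r * b + x * value (p ⊞ r · q) x                  ≈⟨ +-congˡ (*-congˡ (value-⊞ p r q x)) ⟩
    c + r * b + x * (value p x + r * value q x)          ≈⟨ solve 6 (λ c r b x P Q → c :+ r :* b :+ x :* (P :+ r :* Q) := c :+ x :* P :+ r :* (b :+ x :* Q)) refl c r b x _ _ ⟩
    c + x * value p x + r * (b + x * value q x)          ∎

  value-quotient : ∀ {n} (p : Vec Carrier (suc n)) r x → value p x + value p r ≈ (x + r) * value (quotient p r) x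
  value-quotient (c ∷ [])        r x = solve 3 (λ c r x → c :+ x :* :1 :+ (c :+ r :* :1) := (x :+ r) :* :1) refl c r x
  value-quotient (c ∷ p@(_ ∷ _)) r x = begin
    c + x * value p x + (c + r * value p r)                   ≈⟨ solve 5 (λ c r x P R → c :+ x :* P :+ (c :+ r :* R) := (x :+ r) :* P :+ r :* (P :+ R)) refl c r x _ _ ⟩
    (x + r) * value p x + r * (value p x + value p r)         ≈⟨ +-congˡ (*-congˡ (value-quotient p r x)) ⟩
    (x + r) * value p x + r * ((x + r) * value (quotient p r) x)  ≈⟨ solve 4 (λ r s P Q → s :* P :+ r :* (s :* Q) := s :* (P :+ r :* Q)) refl r (x + r) _ _ ⟩
    (x + r) * (value p x + r * value (quotient p r) x)        ≈⟨ *-congˡ (value-⊞ p r (quotient p r) x) ⟨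
    (x + r) * value (p ⊞ r · quotient p r) x                  ∎

  too-many-roots : ∀ {n} (p : Vec Carrier n) (root : Fin (suc n) → Carrier) → Injective _≡_ _≈_ root →
                   ¬ (∀ i → value p (root i) ≈ 0#)
  too-many-roots []        root root-injective vanish = 1≉0 (vanish zero)
  too-many-roots p@(_ ∷ _) root root-injective vanish =
    too-many-roots (quotient p (root zero)) (root ∘ suc) (Fin.suc-injective ∘ root-injective) (λ i →
      *-cancelˡ-0 (λ eq → suc≢zero (root-injective (x+y≈0⇒x≈y eq)))
        (trans (sym (value-quotient p (root zero) (root (suc i)))) (trans (+-cong (vanish (suc i)) (vanish zero)) (+-identityˡ 0#))))
    where
    suc≢zero : ∀ {n} {i : Fin n} → Fin.suc i ≢ zero
    suc≢zero ()

  value-X^n : ∀ n x → value (replicate n 0#) x ≈ x ^ n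
  value-X^n zero    x = refl
  value-X^n (suc n) x = trans (+-identityˡ _) (*-congˡ (value-X^n n x))

-- Powers of an element whose order divides n

module PowersOfOne (F : Field c ℓ) where
  open Field F hiding (zero)
  open FieldProperties F
  open Exp commutativeSemiring hiding (_^_)
  open ≈-Reasoning setoid

  ^-multiple≈1 : ∀ {y} n → y ^ n ≈ 1# → ∀ i → y ^ (i ℕ.* n) ≈ 1#
  ^-multiple≈1 {y} n yⁿ≈1 i = begin
    y ^ (i ℕ.* n)  ≈⟨ ^-congʳ y (ℕ.*-comm i n) ⟩
    y ^ (n ℕ.* i)  ≈⟨ ^-assocʳ y n i ⟨
    (y ^ n) ^ i    ≈⟨ ^-congˡ i yⁿ≈1 ⟩
    1# ^ i         ≈⟨ 1^n≈1 i ⟩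
    1#             ∎

  ^-% : ∀ {y} n .{{_ : NonZero n}} → y ^ n ≈ 1# → ∀ i → y ^ i ≈ y ^ (i % n)
  ^-% {y} n yⁿ≈1 i = begin
    y ^ i                                ≈⟨ ^-congʳ y (m≡m%n+[m/n]*n i n) ⟩
    y ^ (i % n ℕ.+ (i / n) ℕ.* n)        ≈⟨ ^-homo-* y (i % n) _ ⟩
    y ^ (i % n) * y ^ ((i / n) ℕ.* n)    ≈⟨ *-congˡ (^-multiple≈1 n yⁿ≈1 (i / n)) ⟩
    y ^ (i % n) * 1#                     ≈⟨ *-identityʳ _ ⟩
    y ^ (i % n)                          ∎

  ^-cong-% : ∀ {y} n .{{_ : NonZero n}} → y ^ n ≈ 1# → ∀ i j → i % n ≡ j % n → y ^ i ≈ y ^ j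
  ^-cong-% {y} n yⁿ≈1 i j eq = trans (^-% n yⁿ≈1 i) (trans (^-congʳ y eq) (sym (^-% n yⁿ≈1 j)))

  ^-gcd : ∀ {y} m n → y ^ m ≈ 1# → y ^ n ≈ 1# → gcd m n ≡ 1 → y ≈ 1#
  ^-gcd {y} m n yᵐ≈1 yⁿ≈1 gcd≡1 with ≡.subst (λ g → Bézout.Identity g m n) gcd≡1 (Bézout.identity (gcd-GCD m n))
  ... | Bézout.+- i j eq = begin
      y                   ≈⟨ *-identityʳ y ⟨
      y * 1#              ≈⟨ *-congˡ (^-multiple≈1 n yⁿ≈1 j) ⟨
      y ^ (1 ℕ.+ j ℕ.* n) ≈⟨ ^-congʳ y eq ⟩
      y ^ (i ℕ.* m)       ≈⟨ ^-multiple≈1 m yᵐ≈1 i ⟩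
      1#                  ∎
  ... | Bézout.-+ i j eq = begin
      y                   ≈⟨ *-identityʳ y ⟨
      y * 1#              ≈⟨ *-congˡ (^-multiple≈1 m yᵐ≈1 i) ⟨
      y ^ (1 ℕ.+ i ℕ.* m) ≈⟨ ^-congʳ y eq ⟩
      y ^ (j ℕ.* n)       ≈⟨ ^-multiple≈1 n yⁿ≈1 j ⟩
      1#                  ∎

-- Power sums over a field of order 2^N

module BinaryFiniteField (F : Field c ℓ) {N : ℕ} (enumeration : HasOrder F (2 ℕ.^ N)) where
  open Field F hiding (zero)
  open FieldProperties F public
  open FiniteField F enumeration public
  open Exp commutativeSemiring public hiding (_^_)
  open Mult semiring using (×1-homo-*) renaming (_×_ to _·_)
  open SemiringSum semiring using (∑-distrib-+; sum-replicate; *-distribˡ-sum; sum-cong-≋)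
  open ≈-Reasoning setoid

  -- Counting gives `2 ^ N · 1 = 0`; without zero divisors, a factor 2 must vanish.
  1+1≈0 : 1# + 1# ≈ 0#
  1+1≈0 = trans (+-congˡ (sym (+-identityʳ 1#))) (decidable-stable (2 · 1# ≟ 0#) (λ 2≉0 → 2^≉0 2≉0 N order·1≈0))
    where
    2^≉0 : ¬ (2 · 1# ≈ 0#) → ∀ j → ¬ ((2 ℕ.^ j) · 1# ≈ 0#)
    2^≉0 2≉0 zero    eq = 1≉0 (trans (sym (+-identityʳ 1#)) eq)
    2^≉0 2≉0 (suc j) eq = *-≉0 2≉0 (2^≉0 2≉0 j) (trans (sym (×1-homo-* 2 (2 ℕ.^ j))) eq)

  open Char2Field F 1+1≈0 public

  frob-order : ∀ x → frob N x ≈ x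
  frob-order = x^order≈x {{ℕ.m^n≢0 2 N}}

  open Bijection enumeration using (to; injective)

  -- Otherwise `X + X^(2+e)` would vanish on the whole field. The extra factor `X` covers 0, so the
  -- enumeration of the field itself supplies the roots.
  ¬all-roots-of-unity : ∀ e → 2 ℕ.+ e < 2 ℕ.^ N → ¬ (∀ y → ¬ (y ≈ 0#) → y ^ suc e ≈ 1#)
  ¬all-roots-of-unity e e<order all = too-many-roots X+X^[2+e] (to ∘ λ i → Fin.inject≤ i e<order)
    (Fin.inject≤-injective e<order e<order _ _ ∘ injective) (λ i → vanishes _)
    where
    X+X^[2+e] : Vec Carrier (2 ℕ.+ e)
    X+X^[2+e] = 0# ∷ 1# ∷ replicate e 0#

    vanishes : ∀ y → value X+X^[2+e] y ≈ 0#
    vanishes y with y ≟ 0#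
    ... | yes y≈0 = trans (+-identityˡ _) (trans (*-congʳ y≈0) (zeroˡ _))
    ... | no y≉0  = trans (+-identityˡ _) (trans (*-congˡ (trans (+-congˡ (trans (*-congˡ (value-X^n e y)) (all y y≉0))) 1+1≈0)) (zeroʳ y))

  -- Substituting `y x` for `x` multiplies the sum by `y ^ e`; a nonzero sum would therefore force
  -- `y ^ e = 1` for every nonzero `y`.
  power-sum≈0 : ∀ e → ¬ (∀ y → ¬ (y ≈ 0#) → y ^ e ≈ 1#) → ∑ (_^ e) ≈ 0#
  power-sum≈0 e ¬all = decidable-stable (∑ (_^ e) ≟ 0#) (λ ∑≉0 → ¬all (λ y y≉0 → *-cancelˡ-≉0 ∑≉0 (begin
    ∑ (_^ e) * y ^ e         ≈⟨ *-comm _ _ ⟩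
    y ^ e * ∑ (_^ e)         ≈⟨ *-distribˡ-sum (y ^ e) (λ i → to i ^ e) ⟩
    ∑ (λ x → y ^ e * x ^ e)  ≈⟨ sum-cong-≋ (λ i → ^-distrib-* y (to i) e) ⟨
    ∑ (λ x → (y * x) ^ e)    ≈⟨ sum-reindex *-congˡ (*-cancelˡ-≉0 y≉0) +-commutativeMonoid (^-congˡ e) ⟩
    ∑ (_^ e)                 ≈⟨ *-identityʳ _ ⟨
    ∑ (_^ e) * 1#            ∎)))

  -- Since the order of the field vanishes in it, 1 may be added to every term; then only the term
  -- at 0 survives.
  power-sum≈1 : ∀ e .{{_ : NonZero e}} → (∀ y → ¬ (y ≈ 0#) → y ^ e ≈ 1#) → ∑ (_^ e) ≈ 1#
  power-sum≈1 e all = begin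
    ∑ (_^ e)                     ≈⟨ +-identityˡ _ ⟨
    0# + ∑ (_^ e)                ≈⟨ +-congʳ order·1≈0 ⟨
    (2 ℕ.^ N) · 1# + ∑ (_^ e)    ≈⟨ +-congʳ (sum-replicate (2 ℕ.^ N)) ⟨
    ∑ (λ _ → 1#) + ∑ (_^ e)      ≈⟨ ∑-distrib-+ (λ _ → 1#) (λ i → to i ^ e) ⟨
    ∑ (λ x → 1# + x ^ e)         ≈⟨ sum-supported-at +-commutativeMonoid _ (index 0#) (λ j j≢ →
        x≈y⇒x+y≈0 (sym (all (to j) (λ toj≈0 → j≢ (injective (trans toj≈0 (sym (to-index 0#)))))))) ⟩
    1# + to (index 0#) ^ e       ≈⟨ +-congˡ (trans (^-congˡ e (to-index 0#)) (0^n≈0 e)) ⟩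
    1# + 0#                      ≈⟨ +-identityʳ 1# ⟩
    1#                           ∎

-- Conjugation, norm and determinant of F_{q²} over F_q, and the bijection θ

module QuadraticExtension (F : Field c ℓ) (k l : ℕ) .{{_ : NonZero k}} .{{_ : NonZero l}}
                          (enumeration : HasOrder F (2 ℕ.^ (k ℕ.* 2))) where
  open Field F hiding (zero)
  open BinaryFiniteField F {k ℕ.* 2} enumeration public
  open PowersOfOne F
  open ≈-Reasoning setoid

  q Q J : ℕ
  q = 2 ℕ.^ k
  Q = 2 ℕ.^ l
  -- 2J ≡ -Q modulo q - 1, so that norm z ^ J is homogeneous of degree -Q over F_q.
  J = 2 ℕ.^ (l ∸ 1) ℕ.* (q ∸ 2)

  bar σ norm : Carrier → Carrier
  bar = frob k
  σ = frob l
  norm x = x * bar x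

  -- The determinant of the rows `(x, x̄)` and `(y, ȳ)`; it vanishes exactly when `x` and `y` are
  -- dependent over F_q.
  det : Carrier → Carrier → Carrier
  det x y = x * bar y + bar x * y

  2≤q : 2 ℕ.≤ q
  2≤q = ℕ.^-monoʳ-≤ 2 (ℕ.>-nonZero⁻¹ k)

  1+[q∸1]≡q : 1 ℕ.+ (q ∸ 1) ≡ q
  1+[q∸1]≡q = ℕ.m+[n∸m]≡n (ℕ.m^n>0 2 k)

  1+[Q∸1]≡Q : 1 ℕ.+ (Q ∸ 1) ≡ Q
  1+[Q∸1]≡Q = ℕ.m+[n∸m]≡n (ℕ.m^n>0 2 l)

  1+[q∸2]≡q∸1 : 1 ℕ.+ (q ∸ 2) ≡ q ∸ 1
  1+[q∸2]≡q∸1 = ≡.sym (ℕ.+-∸-assoc 1 2≤q)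

  bar-involutive : ∀ x → bar (bar x) ≈ x
  bar-involutive x = trans (frob-∘ k k x) (trans (^-congʳ x (≡.cong (2 ℕ.^_) k+k≡k*2)) (frob-order x))
    where
    k+k≡k*2 : k ℕ.+ k ≡ k ℕ.* 2
    k+k≡k*2 = ≡.trans (≡.cong (k ℕ.+_) (≡.sym (ℕ.+-identityʳ k))) (ℕ.*-comm 2 k)

  fixed-norm : ∀ x → Fixed k (norm x)
  fixed-norm x = trans (frob-* k x (bar x)) (trans (*-congˡ (bar-involutive x)) (*-comm _ _))

  fixed-^ : ∀ {s} n → Fixed k s → Fixed k (s ^ n)
  fixed-^ n fs = trans (frob-^ k _ n) (^-congˡ n fs)

  norm-≉0 : ∀ {x} → ¬ (x ≈ 0#) → ¬ (norm x ≈ 0#)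
  norm-≉0 x≉0 = *-≉0 x≉0 (frob-≉0 k x≉0)

  x*x^[q∸1] : ∀ x → x * x ^ (q ∸ 1) ≈ bar x
  x*x^[q∸1] x = ^-congʳ x 1+[q∸1]≡q

  x*x^[Q∸1] : ∀ x → x * x ^ (Q ∸ 1) ≈ σ x
  x*x^[Q∸1] x = ^-congʳ x 1+[Q∸1]≡Q

  fixed^[q∸1]≈1 : ∀ {s} → ¬ (s ≈ 0#) → Fixed k s → s ^ (q ∸ 1) ≈ 1#
  fixed^[q∸1]≈1 {s} s≉0 fs = *-cancelˡ-≉0 s≉0 (trans (x*x^[q∸1] s) (trans fs (sym (*-identityʳ s))))

  [x^[q∸1]]^[1+q]≈1 : ∀ {x} → ¬ (x ≈ 0#) → (x ^ (q ∸ 1)) ^ (1 ℕ.+ q) ≈ 1#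
  [x^[q∸1]]^[1+q]≈1 {x} x≉0 = *-cancelˡ-≉0 (norm-≉0 x≉0) (begin
    x * bar x * (y * bar y)    ≈⟨ solve 4 (λ x b y c → x :* b :* (y :* c) := (x :* y) :* (b :* c)) refl x _ y _ ⟩
    x * y * (bar x * bar y)    ≈⟨ *-congˡ (frob-* k x y) ⟨
    x * y * bar (x * y)        ≈⟨ *-cong (x*x^[q∸1] x) (trans (frob-cong k (x*x^[q∸1] x)) (bar-involutive x)) ⟩
    bar x * x                  ≈⟨ *-comm _ _ ⟩
    x * bar x                  ≈⟨ *-identityʳ _ ⟨
    x * bar x * 1#             ∎)
    where y = x ^ (q ∸ 1)

  -- If conjugation were trivial, all `q² - 1` nonzero elements would satisfy `y^(q-1) = 1`.
  unfixed : ∃ λ y → ¬ (Fixed k y)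
  unfixed with Fin.any? (λ i → ¬? (bar (Bijection.to enumeration i) ≟ Bijection.to enumeration i))
  ... | yes (i , unfixed) = Bijection.to enumeration i , unfixed
  ... | no ¬unfixed = ⊥-elim (¬all-roots-of-unity (q ∸ 2) 2+[q∸2]<q² (λ y y≉0 →
          trans (^-congʳ y 1+[q∸2]≡q∸1) (fixed^[q∸1]≈1 y≉0 (all-fixed y))))
    where
    open Bijection enumeration using (to)
    2+[q∸2]<q² : 2 ℕ.+ (q ∸ 2) < 2 ℕ.^ (k ℕ.* 2)
    2+[q∸2]<q² = ≡.subst (_< 2 ℕ.^ (k ℕ.* 2)) (≡.sym (ℕ.m+[n∸m]≡n 2≤q))
      (ℕ.^-monoʳ-< 2 (s≤s (s≤s z≤n)) (ℕ.m<m*n k 2 (s≤s (s≤s z≤n))))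
    all-fixed : ∀ y → Fixed k y
    all-fixed y = decidable-stable (bar y ≟ y) (λ y-unfixed → ¬unfixed (index y , λ eq →
      y-unfixed (trans (frob-cong k (sym (to-index y))) (trans eq (to-index y)))))

  -- For any `y` outside F_q, `s = y + ȳ` is a nonzero element of F_q, and `y / s` has relative
  -- trace 1.
  affine-point : ∃ λ z → bar z ≈ z + 1#
  affine-point = z , (begin
    bar (y * t)       ≈⟨ frob-* k y t ⟩
    bar y * bar t     ≈⟨ *-congˡ (fixed-inverse k st≈1 fixed-s) ⟩
    bar y * t         ≈⟨ solve 3 (λ y b t → b :* t := y :* t :+ (y :+ b) :* t) refl y (bar y) t ⟩
    y * t + s * t     ≈⟨ +-congˡ st≈1 ⟩
    z + 1#            ∎)
    where
    y = proj₁ unfixed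
    s = y + bar y
    s≉0 : ¬ (s ≈ 0#)
    s≉0 s≈0 = proj₂ unfixed (sym (x+y≈0⇒x≈y s≈0))
    fixed-s : Fixed k s
    fixed-s = trans (frob-+ k y (bar y)) (trans (+-congˡ (bar-involutive y)) (+-comm _ _))
    t = inv s s≉0
    st≈1 = proj₂ (invertible s s≉0)
    z = y * t

  det-cong : ∀ {x x′ y y′} → x ≈ x′ → y ≈ y′ → det x y ≈ det x′ y′
  det-cong x≈x′ y≈y′ = +-cong (*-cong x≈x′ (frob-cong k y≈y′)) (*-cong (frob-cong k x≈x′) y≈y′)

  det-scale : ∀ {s t} → Fixed k s → Fixed k t → ∀ x y → det (s * x) (t * y) ≈ (s * t) * det x y
  det-scale {s} {t} fs ft x y = begin
    s * x * bar (t * y) + bar (s * x) * (t * y)              ≈⟨ +-cong (*-congˡ (trans (frob-* k t y) (*-congʳ ft))) (*-congʳ (trans (frob-* k s x) (*-congʳ fs))) ⟩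
    s * x * (t * bar y) + s * bar x * (t * y)                ≈⟨ solve 6 (λ s t x y b c → s :* x :* (t :* c) :+ s :* b :* (t :* y) := (s :* t) :* (x :* c :+ b :* y)) refl s t x y _ _ ⟩
    (s * t) * det x y                                        ∎

  det-self : ∀ x → det x x ≈ 0#
  det-self x = x≈y⇒x+y≈0 (*-comm _ _)

  det-proportional : ∀ {s x y} → Fixed k s → x ≈ s * y → det x y ≈ 0#
  det-proportional {s} {x} {y} fs x≈sy = begin
    det x y               ≈⟨ det-cong x≈sy (sym (*-identityˡ y)) ⟩
    det (s * y) (1# * y)  ≈⟨ det-scale fs (frob-1 k) y y ⟩
    (s * 1#) * det y y    ≈⟨ trans (*-congˡ (det-self y)) (zeroʳ _) ⟩
    0#                    ∎

  -- `x = (x ȳ / norm y) y`, and the vanishing determinant says that `x ȳ` equals its own conjugate.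
  proportional : ∀ {x y} → ¬ (y ≈ 0#) → det x y ≈ 0# → ∃ λ s → Fixed k s × x ≈ s * y
  proportional {x} {y} y≉0 det≈0 = t * (x * bar y) , fixed-* k (fixed-inverse k nt≈1 (fixed-norm y)) fixed-xȳ , (begin
    x                           ≈⟨ *-identityʳ x ⟨
    x * 1#                      ≈⟨ *-congˡ nt≈1 ⟨
    x * (norm y * t)            ≈⟨ solve 4 (λ x y b t → x :* (y :* b :* t) := t :* (x :* b) :* y) refl x y _ t ⟩
    t * (x * bar y) * y         ∎)
    where
    t = inv (norm y) (norm-≉0 y≉0)
    nt≈1 = proj₂ (invertible (norm y) (norm-≉0 y≉0))
    fixed-xȳ : Fixed k (x * bar y)
    fixed-xȳ = begin
      bar (x * bar y)      ≈⟨ frob-* k x (bar y) ⟩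
      bar x * bar (bar y)  ≈⟨ *-congˡ (bar-involutive y) ⟩
      bar x * y            ≈⟨ sym (x+y≈0⇒x≈y det≈0) ⟩
      x * bar y            ∎

  -- `2 J = Q (q - 2)`, so the product is `σ s ^ (q ∸ 1)`, the power that is 1 on nonzero elements
  -- of F_q.
  σ*square^J : ∀ {s} → ¬ (s ≈ 0#) → Fixed k s → σ s * (s * s) ^ J ≈ 1#
  σ*square^J {s} s≉0 fs = begin
    σ s * (s * s) ^ J                               ≈⟨ *-congˡ (^-congˡ J (*-congˡ (*-identityʳ s))) ⟨
    σ s * (s ^ 2) ^ J                               ≈⟨ *-congˡ (^-assocʳ (s ^ 2) (2 ℕ.^ (l ∸ 1)) (q ∸ 2)) ⟨
    σ s * (((s ^ 2) ^ (2 ℕ.^ (l ∸ 1))) ^ (q ∸ 2))   ≈⟨ *-congˡ (^-congˡ (q ∸ 2) (trans (frob-∘ (l ∸ 1) 1 s) (^-congʳ s (≡.cong (2 ℕ.^_) (ℕ.m+[n∸m]≡n (ℕ.>-nonZero⁻¹ l)))))) ⟩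
    σ s * σ s ^ (q ∸ 2)                             ≈⟨ ^-congʳ (σ s) 1+[q∸2]≡q∸1 ⟩
    σ s ^ (q ∸ 1)                                   ≈⟨ fixed^[q∸1]≈1 (frob-≉0 l s≉0) (fixed-frob k l fs) ⟩
    1#                                              ∎

  -- The norm factor lies in F_q and disappears on raising to the power `q - 1`. Its exponent makes
  -- the degree `Q - 1 + 2 (J + 1)` congruent to 1 modulo `q - 1`, so `θ` fixes F_q pointwise.
  θ : Carrier → Carrier
  θ z = z ^ (Q ∸ 1) * norm z ^ suc J

  norm-* : ∀ x y → norm (x * y) ≈ norm x * norm y
  norm-* x y = trans (*-congˡ (frob-* k x y)) (solve 4 (λ x y b c → x :* y :* (b :* c) := x :* b :* (y :* c)) refl x y _ _)

  norm-cong : ∀ {x y} → x ≈ y → norm x ≈ norm y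
  norm-cong x≈y = *-cong x≈y (frob-cong k x≈y)

  norm-zero : ∀ {x} → x ≈ 0# → norm x ≈ 0#
  norm-zero x≈0 = trans (*-congʳ x≈0) (zeroˡ _)

  θ-cong : ∀ {x y} → x ≈ y → θ x ≈ θ y
  θ-cong x≈y = *-cong (^-congˡ (Q ∸ 1) x≈y) (^-congˡ (suc J) (norm-cong x≈y))

  θ-* : ∀ x y → θ (x * y) ≈ θ x * θ y
  θ-* x y = begin
    (x * y) ^ (Q ∸ 1) * norm (x * y) ^ suc J                        ≈⟨ *-cong (^-distrib-* x y (Q ∸ 1)) (trans (^-congˡ (suc J) (norm-* x y)) (^-distrib-* (norm x) (norm y) (suc J))) ⟩
    x ^ (Q ∸ 1) * y ^ (Q ∸ 1) * (norm x ^ suc J * norm y ^ suc J)    ≈⟨ solve 4 (λ a b c d → a :* b :* (c :* d) := a :* c :* (b :* d)) refl _ _ _ _ ⟩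
    θ x * θ y                                                       ∎

  θ-≉0 : ∀ {x} → ¬ (x ≈ 0#) → ¬ (θ x ≈ 0#)
  θ-≉0 x≉0 = *-≉0 (^-≉0 (Q ∸ 1) x≉0) (^-≉0 (suc J) (norm-≉0 x≉0))

  θ-zero : ∀ {x} → x ≈ 0# → θ x ≈ 0#
  θ-zero x≈0 = trans (*-congˡ (trans (*-congʳ (norm-zero x≈0)) (zeroˡ _))) (zeroʳ _)

  θ^[q∸1] : ∀ {x} → ¬ (x ≈ 0#) → θ x ^ (q ∸ 1) ≈ (x ^ (q ∸ 1)) ^ (Q ∸ 1)
  θ^[q∸1] {x} x≉0 = begin
    (x ^ (Q ∸ 1) * norm x ^ suc J) ^ (q ∸ 1)                  ≈⟨ ^-distrib-* _ _ (q ∸ 1) ⟩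
    (x ^ (Q ∸ 1)) ^ (q ∸ 1) * (norm x ^ suc J) ^ (q ∸ 1)      ≈⟨ *-congˡ (fixed^[q∸1]≈1 (^-≉0 (suc J) (norm-≉0 x≉0)) (fixed-^ (suc J) (fixed-norm x))) ⟩
    (x ^ (Q ∸ 1)) ^ (q ∸ 1) * 1#                              ≈⟨ *-identityʳ _ ⟩
    (x ^ (Q ∸ 1)) ^ (q ∸ 1)                                   ≈⟨ trans (^-assocʳ x (Q ∸ 1) (q ∸ 1)) (trans (^-congʳ x (ℕ.*-comm (Q ∸ 1) (q ∸ 1))) (sym (^-assocʳ x (q ∸ 1) (Q ∸ 1)))) ⟩
    (x ^ (q ∸ 1)) ^ (Q ∸ 1)                                   ∎

  θ-fixed : ∀ {s} → ¬ (s ≈ 0#) → Fixed k s → θ s ≈ s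
  θ-fixed {s} s≉0 fs = begin
    s ^ (Q ∸ 1) * norm s ^ suc J                   ≈⟨ *-congˡ (^-congˡ (suc J) (*-congˡ fs)) ⟩
    s ^ (Q ∸ 1) * ((s * s) * (s * s) ^ J)          ≈⟨ solve 3 (λ p s t → p :* ((s :* s) :* t) := s :* ((s :* p) :* t)) refl _ s _ ⟩
    s * ((s * s ^ (Q ∸ 1)) * (s * s) ^ J)          ≈⟨ *-congˡ (trans (*-congʳ (x*x^[Q∸1] s)) (σ*square^J s≉0 fs)) ⟩
    s * 1#                                         ≈⟨ *-identityʳ s ⟩
    s                                              ∎

  module _ (coprime : gcd (Q ∸ 1) (1 ℕ.+ q) ≡ 1) where

    -- `x ^ (q ∸ 1)` has order dividing both `Q - 1` and `q + 1`, so it is 1. Hence `x` lies in F_q,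
    -- where `θ` is the identity.
    θ-kernel : ∀ {x} → ¬ (x ≈ 0#) → θ x ≈ 1# → x ≈ 1#
    θ-kernel {x} x≉0 θx≈1 = trans (sym (θ-fixed x≉0 fixed-x)) θx≈1
      where
      x^[q∸1]≈1 : x ^ (q ∸ 1) ≈ 1#
      x^[q∸1]≈1 = ^-gcd (Q ∸ 1) (1 ℕ.+ q)
        (trans (sym (θ^[q∸1] x≉0)) (trans (^-congˡ (q ∸ 1) θx≈1) (1^n≈1 (q ∸ 1)))) ([x^[q∸1]]^[1+q]≈1 x≉0) coprime
      fixed-x : Fixed k x
      fixed-x = trans (sym (x*x^[q∸1] x)) (trans (*-congˡ x^[q∸1]≈1) (*-identityʳ x))

    θ-injective : Injective _≈_ _≈_ θ
    θ-injective {x} {y} θx≈θy with x ≟ 0# | y ≟ 0#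
    ... | yes x≈0 | yes y≈0 = trans x≈0 (sym y≈0)
    ... | yes x≈0 | no y≉0  = ⊥-elim (θ-≉0 y≉0 (trans (sym θx≈θy) (θ-zero x≈0)))
    ... | no x≉0  | yes y≈0 = ⊥-elim (θ-≉0 x≉0 (trans θx≈θy (θ-zero y≈0)))
    ... | no x≉0  | no y≉0  = begin
      x                ≈⟨ *-identityˡ x ⟨
      1# * x           ≈⟨ *-congʳ y*t≈1 ⟨
      y * t * x        ≈⟨ solve 3 (λ x y t → y :* t :* x := y :* (x :* t)) refl x y t ⟩
      y * (x * t)      ≈⟨ *-congˡ xt≈1 ⟩
      y * 1#           ≈⟨ *-identityʳ y ⟩
      y                ∎
      where
      t = inv y y≉0
      y*t≈1 = proj₂ (invertible y y≉0)
      xt≈1 : x * t ≈ 1#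
      xt≈1 = θ-kernel (*-≉0 x≉0 (inverse-≉0 y*t≈1)) (begin
        θ (x * t)    ≈⟨ θ-* x t ⟩
        θ x * θ t    ≈⟨ *-congʳ θx≈θy ⟩
        θ y * θ t    ≈⟨ θ-* y t ⟨
        θ (y * t)    ≈⟨ θ-cong y*t≈1 ⟩
        θ 1#         ≈⟨ θ-fixed 1≉0 (frob-1 k) ⟩
        1#           ∎)

-- From injectivity to separation of F_q-lines

module Lines (F : Field c ℓ) (k l : ℕ) .{{_ : NonZero k}} .{{_ : NonZero l}}
             (enumeration : HasOrder F (2 ℕ.^ (k ℕ.* 2))) where
  open Field F hiding (zero)
  open QuadraticExtension F k l enumeration public
  open PowersOfOne F
  open ≈-Reasoning setoid

  det-sym : ∀ x y → det x y ≈ det y x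
  det-sym x y = solve 4 (λ x y b c → x :* c :+ b :* y := y :* b :+ c :* x) refl x y _ _

  fixed-0 : Fixed k 0#
  fixed-0 = 0^n≈0 q {{ℕ.m^n≢0 2 k}}

  det-zeroˡ : ∀ {x y} → x ≈ 0# → det x y ≈ 0#
  det-zeroˡ {x} {y} x≈0 = det-proportional fixed-0 (trans x≈0 (sym (zeroˡ y)))

  module Homogeneous {G : Carrier → Carrier} (G-cong : Congruent _≈_ _≈_ G)
                     (G-scale : ∀ {s} → Fixed k s → ∀ z → G (s * z) ≈ (s * σ s) * G z) where

    SeparatesLines : Set _
    SeparatesLines = ∀ z w → det (G z) (G w) ≈ 0# → det z w ≈ 0#

    -- `G` has degree `Q + 1` over F_q and the norm factor degree `-Q`; the product has degree 1, so
    -- its injectivity can be decided line by line.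
    reduced : Carrier → Carrier
    reduced z = norm z ^ J * G z

    reduced-cong : Congruent _≈_ _≈_ reduced
    reduced-cong z≈w = *-cong (^-congˡ J (norm-cong z≈w)) (G-cong z≈w)

    reduced-scale : ∀ {s} → ¬ (s ≈ 0#) → Fixed k s → ∀ z → reduced (s * z) ≈ s * reduced z
    reduced-scale {s} s≉0 fs z = begin
      norm (s * z) ^ J * G (s * z)                        ≈⟨ *-cong (trans (^-congˡ J (trans (norm-* s z) (*-congʳ (*-congˡ fs)))) (^-distrib-* (s * s) (norm z) J)) (G-scale fs z) ⟩
      (s * s) ^ J * norm z ^ J * (s * σ s * G z)          ≈⟨ solve 5 (λ t n s r g → t :* n :* (s :* r :* g) := s :* ((r :* t) :* (n :* g))) refl _ _ s _ _ ⟩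
      s * (σ s * (s * s) ^ J * reduced z)                 ≈⟨ *-congˡ (trans (*-congʳ (σ*square^J s≉0 fs)) (*-identityˡ _)) ⟩
      s * reduced z                                       ∎

    G-zero : ∀ {z} → z ≈ 0# → G z ≈ 0#
    G-zero {z} z≈0 = begin
      G z                  ≈⟨ G-cong (trans z≈0 (sym (zeroˡ z))) ⟩
      G (0# * z)           ≈⟨ G-scale fixed-0 z ⟩
      0# * σ 0# * G z      ≈⟨ trans (*-congʳ (zeroˡ _)) (zeroˡ _) ⟩
      0#                   ∎

    reduced-zero : ∀ {z} → z ≈ 0# → reduced z ≈ 0#
    reduced-zero z≈0 = trans (*-congˡ (G-zero z≈0)) (zeroʳ _)

    det-reduced : ∀ z w → det (reduced z) (reduced w) ≈ norm z ^ J * norm w ^ J * det (G z) (G w)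
    det-reduced z w = det-scale (fixed-^ J (fixed-norm z)) (fixed-^ J (fixed-norm w)) (G z) (G w)

    -- If `G z` and `G w` are proportional, then `reduced z = s * reduced w = reduced (s *
    -- w)` with `s` in F_q, and injectivity gives `z = s * w`.
    injective⇒separates : Injective _≈_ _≈_ reduced → SeparatesLines
    injective⇒separates injective z w detG≈0 = decidable-stable (det z w ≟ 0#) λ det≉0 →
      let
        z≉0 : ¬ (z ≈ 0#)
        z≉0 = det≉0 ∘ det-zeroˡ
        w≉0 : ¬ (w ≈ 0#)
        w≉0 w≈0 = det≉0 (trans (det-sym z w) (det-zeroˡ w≈0))
        reduced≉0 : ∀ {x} → ¬ (x ≈ 0#) → ¬ (reduced x ≈ 0#)
        reduced≉0 x≉0 eq = x≉0 (injective (trans eq (sym (reduced-zero refl))))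
        (s , fs , z*≈sw*) = proportional (reduced≉0 w≉0) (trans (det-reduced z w) (trans (*-congˡ detG≈0) (zeroʳ _)))
        s≉0 : ¬ (s ≈ 0#)
        s≉0 s≈0 = reduced≉0 z≉0 (trans z*≈sw* (trans (*-congʳ s≈0) (zeroˡ _)))
      in det≉0 (det-proportional fs (injective (trans z*≈sw* (sym (reduced-scale s≉0 fs w)))))

    module _ (separates : SeparatesLines) where

      -- If `G z = 0`, its determinant with every value of `G` vanishes, so `z` would be
      -- proportional to `z * y` for a `y` outside F_q.
      G-≉0 : ∀ {z} → ¬ (z ≈ 0#) → ¬ (G z ≈ 0#)
      G-≉0 {z} z≉0 Gz≈0 = proj₂ unfixed (sym (x+y≈0⇒x≈y (*-cancelˡ-0 (norm-≉0 z≉0) (begin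
        norm z * (y + bar y)                 ≈⟨ solve 4 (λ z b y c → z :* b :* (y :+ c) := z :* (b :* c) :+ b :* (z :* y)) refl z _ y _ ⟩
        z * (bar z * bar y) + bar z * (z * y)  ≈⟨ +-congʳ (*-congˡ (frob-* k z y)) ⟨
        det z (z * y)                        ≈⟨ separates z (z * y) (det-zeroˡ Gz≈0) ⟩
        0#                                   ∎))))
        where y = proj₁ unfixed

      reduced-≉0 : ∀ {z} → ¬ (z ≈ 0#) → ¬ (reduced z ≈ 0#)
      reduced-≉0 z≉0 = *-≉0 (^-≉0 J (norm-≉0 z≉0)) (G-≉0 z≉0)

      -- Equal nonzero values put `z` and `w` on one line, say `z = s * w`; homogeneity of degree 1
      -- then gives `s = 1`.
      separates⇒injective : Injective _≈_ _≈_ reduced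
      separates⇒injective {z} {w} z*≈w* with z ≟ 0# | w ≟ 0#
      ... | yes z≈0 | yes w≈0 = trans z≈0 (sym w≈0)
      ... | yes z≈0 | no w≉0  = ⊥-elim (reduced-≉0 w≉0 (trans (sym z*≈w*) (reduced-zero z≈0)))
      ... | no z≉0  | yes w≈0 = ⊥-elim (reduced-≉0 z≉0 (trans z*≈w* (reduced-zero w≈0)))
      ... | no z≉0  | no w≉0  = trans z≈sw (trans (*-congʳ s≈1) (*-identityˡ w))
        where
        detG≈0 : det (G z) (G w) ≈ 0#
        detG≈0 = *-cancelˡ-0 (*-≉0 (^-≉0 J (norm-≉0 z≉0)) (^-≉0 J (norm-≉0 w≉0)))
          (trans (sym (det-reduced z w)) (trans (det-cong z*≈w* refl) (det-self _)))
        ratio = proportional w≉0 (separates z w detG≈0)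
        s = proj₁ ratio
        z≈sw = proj₂ (proj₂ ratio)
        s≉0 : ¬ (s ≈ 0#)
        s≉0 s≈0 = z≉0 (trans z≈sw (trans (*-congʳ s≈0) (zeroˡ w)))
        s≈1 : s ≈ 1#
        s≈1 = *-cancelˡ-≉0 (reduced-≉0 w≉0) (begin
          reduced w * s    ≈⟨ *-comm _ _ ⟩
          s * reduced w    ≈⟨ reduced-scale s≉0 (proj₁ (proj₂ ratio)) w ⟨
          reduced (s * w)  ≈⟨ reduced-cong z≈sw ⟨
          reduced z        ≈⟨ z*≈w* ⟩
          reduced w        ≈⟨ *-identityʳ _ ⟨
          reduced w * 1#   ∎)

  module _ (a d : Carrier) where

    -- The arguments stand for `z^Q`, `z̄^Q`, `z`, `z̄`. Keeping them independent turns later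
    -- identities into polynomial ones that the solver can check.
    form : Carrier → Carrier → Carrier → Carrier → Carrier
    form X X̄ y ȳ = d * (X * y) + X * ȳ + a * (X̄ * ȳ)

    form-cong : ∀ {X X′ X̄ X̄′ y y′ ȳ ȳ′} → X ≈ X′ → X̄ ≈ X̄′ → y ≈ y′ → ȳ ≈ ȳ′ → form X X̄ y ȳ ≈ form X′ X̄′ y′ ȳ′
    form-cong X X̄ y ȳ = +-cong (+-cong (*-congˡ (*-cong X y)) (*-cong X ȳ)) (*-congˡ (*-cong X̄ ȳ))

    form-bar : Fixed k a → Fixed k d → ∀ X X̄ y ȳ → bar (form X X̄ y ȳ) ≈ form (bar X) (bar X̄) (bar y) (bar ȳ)
    form-bar fa fd X X̄ y ȳ = trans (frob-+ k _ _) (+-cong (trans (frob-+ k _ _) (+-cong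
      (trans (frob-* k d _) (*-cong fd (frob-* k X y))) (frob-* k X ȳ))) (trans (frob-* k a _) (*-cong fa (frob-* k X̄ ȳ))))

    N : Carrier → Carrier
    N z = form (σ z) (σ (bar z)) z (bar z)

    N-cong : Congruent _≈_ _≈_ N
    N-cong z≈w = form-cong (frob-cong l z≈w) (frob-cong l (frob-cong k z≈w)) z≈w (frob-cong k z≈w)

    bar-N : Fixed k a → Fixed k d → ∀ z → bar (N z) ≈ form (σ (bar z)) (σ z) (bar z) z
    bar-N fa fd z = trans (form-bar fa fd _ _ _ _) (form-cong (frob-comm k l z)
      (trans (frob-comm k l (bar z)) (frob-cong l (bar-involutive z))) refl (bar-involutive z))

    N-scale : ∀ {s} → Fixed k s → ∀ z → N (s * z) ≈ (s * σ s) * N z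
    N-scale {s} fs z = begin
      N (s * z)                                                 ≈⟨ form-cong (frob-* l s z) (trans (frob-cong l s̄z) (frob-* l s (bar z))) refl s̄z ⟩
      form (σ s * σ z) (σ s * σ (bar z)) (s * z) (s * bar z)    ≈⟨ solve 8 (λ a d s t X X̄ z b →
           d :* ((t :* X) :* (s :* z)) :+ (t :* X) :* (s :* b) :+ a :* ((t :* X̄) :* (s :* b)) :=
           (s :* t) :* (d :* (X :* z) :+ X :* b :+ a :* (X̄ :* b))) refl a d s _ _ _ z _ ⟩
      s * σ s * N z                                             ∎
      where
      s̄z : bar (s * z) ≈ s * bar z
      s̄z = trans (frob-* k s z) (*-congʳ fs)

    open Homogeneous N-cong N-scale public

    module _ (u v : ℕ) (u≡ : (u ℕ.* (Q ∸ 1)) % (1 ℕ.+ q) ≡ Q % (1 ℕ.+ q))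
                       (v≡ : (v ℕ.* (Q ∸ 1)) % (1 ℕ.+ q) ≡ q % (1 ℕ.+ q)) where

      trinomial : Carrier → Carrier
      trinomial x = x * (1# + a * (x ^ (q ∸ 1)) ^ u + d * (x ^ (q ∸ 1)) ^ v)

      trinomial-cong : Congruent _≈_ _≈_ trinomial
      trinomial-cong x≈y = *-cong x≈y (+-cong (+-congˡ (*-congˡ (^-congˡ u x^≈))) (*-congˡ (^-congˡ v x^≈)))
        where x^≈ = ^-congˡ (q ∸ 1) x≈y

      -- With `y = z^(q-1)`, the power `θ z ^ (q ∸ 1)` is `y^(Q-1)`, and the congruences for `u` and
      -- `v` turn its powers into `y^Q` and `y^q`. The rest is `z y = z̄` and `z̄ ȳ = z`.
      trinomial-θ : ∀ z → trinomial (θ z) ≈ reduced z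
      trinomial-θ z with z ≟ 0#
      ... | yes z≈0 = trans (*-congʳ (θ-zero z≈0)) (trans (zeroˡ _) (sym (reduced-zero z≈0)))
      ... | no z≉0  = begin
        θ z * (1# + a * (θ z ^ (q ∸ 1)) ^ u + d * (θ z ^ (q ∸ 1)) ^ v)  ≈⟨ *-congˡ (+-cong (+-congˡ (*-congˡ (power u Q u≡))) (*-congˡ (power v q v≡))) ⟩
        θ z * (1# + a * σ y + d * bar y)                                ≈⟨ solve 8 (λ p z b n a d Y B →
            p :* (z :* b :* n) :* (:1 :+ a :* Y :+ d :* B) := n :* (d :* ((z :* p) :* (b :* B)) :+ (z :* p) :* b :+ a :* ((z :* p :* Y) :* b)))
            refl (z ^ (Q ∸ 1)) z (bar z) (norm z ^ J) a d (σ y) (bar y) ⟩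
        norm z ^ J * (d * (z * z ^ (Q ∸ 1) * (bar z * bar y)) + (z * z ^ (Q ∸ 1)) * bar z + a * (z * z ^ (Q ∸ 1) * σ y * bar z))
          ≈⟨ *-congˡ (+-cong (+-cong (*-congˡ (*-cong Z≈ z̄ȳ≈)) (*-congʳ Z≈)) (*-congˡ (*-congʳ (trans (*-congʳ Z≈) (trans (sym (frob-* l z y)) (frob-cong l (x*x^[q∸1] z))))))) ⟩
        reduced z                                                        ∎
        where
        y = z ^ (q ∸ 1)
        power : ∀ u n → (u ℕ.* (Q ∸ 1)) % (1 ℕ.+ q) ≡ n % (1 ℕ.+ q) → (θ z ^ (q ∸ 1)) ^ u ≈ y ^ n
        power u n u≡ = begin
          (θ z ^ (q ∸ 1)) ^ u    ≈⟨ ^-congˡ u (θ^[q∸1] z≉0) ⟩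
          (y ^ (Q ∸ 1)) ^ u      ≈⟨ trans (^-assocʳ y (Q ∸ 1) u) (^-congʳ y (ℕ.*-comm (Q ∸ 1) u)) ⟩
          y ^ (u ℕ.* (Q ∸ 1))    ≈⟨ ^-cong-% (1 ℕ.+ q) ([x^[q∸1]]^[1+q]≈1 z≉0) (u ℕ.* (Q ∸ 1)) n u≡ ⟩
          y ^ n                  ∎
        Z≈ = x*x^[Q∸1] z
        z̄ȳ≈ : bar z * bar y ≈ z
        z̄ȳ≈ = trans (sym (frob-* k z y)) (trans (frob-cong k (x*x^[q∸1] z)) (bar-involutive z))

      module _ (coprime : gcd (Q ∸ 1) (1 ℕ.+ q) ≡ 1) where

        trinomial-injective⇒separates : Injective _≈_ _≈_ trinomial → SeparatesLines
        trinomial-injective⇒separates trinomial-injective = injective⇒separates (λ {z} {w} eq →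
          θ-injective coprime (trinomial-injective (trans (trinomial-θ z) (trans eq (sym (trinomial-θ w))))))

        separates⇒trinomial-injective : SeparatesLines → Injective _≈_ _≈_ trinomial
        separates⇒trinomial-injective separates {x} {y} fx≈fy =
          let (z , θz≈x) = injective⇒preimage θ-cong (θ-injective coprime) x
              (w , θw≈y) = injective⇒preimage θ-cong (θ-injective coprime) y
          in trans (sym θz≈x) (trans (θ-cong (separates⇒injective separates (begin
               reduced z  ≈⟨ trinomial-θ z ⟨
               trinomial (θ z)    ≈⟨ trinomial-cong θz≈x ⟩
               trinomial x        ≈⟨ fx≈fy ⟩
               trinomial y        ≈⟨ trinomial-cong θw≈y ⟨
               trinomial (θ w)    ≈⟨ trinomial-θ w ⟩
               reduced w  ∎))) θw≈y)

-- Artin-Schreier roots and the trace condition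

module Traces (F : Field c ℓ) (k l : ℕ) .{{_ : NonZero k}} .{{_ : NonZero l}}
              (enumeration : HasOrder F (2 ℕ.^ (k ℕ.* 2))) where
  open Field F hiding (zero)
  open Lines F k l enumeration public
  open ≈-Reasoning setoid

  frob-suc : ∀ j x → frob (suc j) x ≈ frob j x * frob j x
  frob-suc j x = trans (sym (frob-∘ j 1 x)) (trans (frob-cong j (*-congˡ (*-identityʳ x))) (frob-* j x x))

  tr-suc : ∀ i n x → tr i (suc n) x ≈ tr i n x + frob (n ℕ.* i) x
  tr-suc i n x = begin
    x + frob i t                      ≈⟨ solve 3 (λ x p t → x :+ p := t :+ ((p :+ t) :+ x)) refl x (frob i t) t ⟩
    t + (frob i t + t + x)            ≈⟨ +-congˡ (+-congʳ (tr-telescope i n x)) ⟩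
    t + (frob (n ℕ.* i) x + x + x)    ≈⟨ solve 3 (λ x p t → t :+ (p :+ x :+ x) := t :+ p) refl x _ t ⟩
    t + frob (n ℕ.* i) x              ∎
    where t = tr i n x

  frob₁ : ∀ x → frob 1 x ≈ x * x
  frob₁ x = *-congˡ (*-identityʳ x)

  -- Additive Hilbert 90 over F₂, made explicit by the element n = z² + z of F_q, whose absolute trace is z̄ + z = 1.
  artin-schreier : ∀ {D} → Fixed k D → ∃ λ ζ → ζ * ζ + ζ ≈ D
  artin-schreier {D} fD = S k + t * z , (begin
    (S k + t * z) * (S k + t * z) + (S k + t * z)                ≈⟨ solve 3 (λ s t z → (s :+ t :* z) :* (s :+ t :* z) :+ (s :+ t :* z) := (s :* s :+ s) :+ ((t :* t) :* (z :* z) :+ t :* z)) refl (S k) t z ⟩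
    (S k * S k + S k) + (t * t * (z * z) + t * z)                ≈⟨ +-cong (S²+S k) (+-congʳ (*-congʳ t²≈t)) ⟩
    (frob (k ℕ.* 1) n * t + D * frob 1 (tr 1 k n)) + (t * (z * z) + t * z)   ≈⟨ +-congʳ (+-cong (*-congʳ n-fixed) (*-congˡ (trans (frob-cong 1 tr-n) (frob-1 1)))) ⟩
    (n * t + D * 1#) + (t * (z * z) + t * z)                     ≈⟨ solve 3 (λ z t d → ((z :* z :+ z) :* t :+ d :* :1) :+ (t :* (z :* z) :+ t :* z) := d) refl z t D ⟩
    D                                                            ∎)
    where
    z = proj₁ affine-point
    n = z * z + z
    t = tr 1 k D

    frob-k*1 : ∀ x → frob (k ℕ.* 1) x ≈ bar x
    frob-k*1 x = ^-congʳ x (≡.cong (2 ℕ.^_) (ℕ.*-identityʳ k))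

    tr-n : tr 1 k n ≈ 1#
    tr-n = begin
      tr 1 k (z * z + z)             ≈⟨ tr-cong 1 k (+-congʳ (frob₁ z)) ⟨
      tr 1 k (frob 1 z + z)          ≈⟨ tr-+ 1 k _ _ ⟩
      tr 1 k (frob 1 z) + tr 1 k z   ≈⟨ +-congʳ (tr-frob 1 k 1 z) ⟩
      frob 1 (tr 1 k z) + tr 1 k z   ≈⟨ tr-telescope 1 k z ⟩
      frob (k ℕ.* 1) z + z           ≈⟨ +-congʳ (trans (frob-k*1 z) (proj₂ affine-point)) ⟩
      z + 1# + z                     ≈⟨ solve 1 (λ z → z :+ :1 :+ z := :1) refl z ⟩
      1#                             ∎

    n-fixed : frob (k ℕ.* 1) n ≈ n
    n-fixed = begin
      frob (k ℕ.* 1) n           ≈⟨ frob-k*1 n ⟩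
      bar (z * z + z)            ≈⟨ trans (frob-+ k _ _) (+-congʳ (frob-* k z z)) ⟩
      bar z * bar z + bar z      ≈⟨ +-cong (*-cong z̄ z̄) z̄ ⟩
      (z + 1#) * (z + 1#) + (z + 1#)  ≈⟨ solve 1 (λ z → (z :+ :1) :* (z :+ :1) :+ (z :+ :1) := z :* z :+ z) refl z ⟩
      n                          ∎
      where z̄ = proj₂ affine-point

    t²≈t : t * t ≈ t
    t²≈t = x+y≈0⇒x≈y (begin
      t * t + t              ≈⟨ +-congʳ (frob₁ t) ⟨
      frob 1 t + t           ≈⟨ tr-telescope 1 k D ⟩
      frob (k ℕ.* 1) D + D   ≈⟨ x≈y⇒x+y≈0 (trans (frob-k*1 D) fD) ⟩
      0#                     ∎)

    S : ℕ → Carrier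
    S zero    = 0#
    S (suc j) = S j + frob (j ℕ.* 1) n * tr 1 j D

    -- Squaring a summand of `S` gives the next one plus a multiple of `D`, so `S j * S j + S j`
    -- telescopes. For `j = k` it equals `n t + D`; as `n = z² + z` and `t² = t`, adding `t z` to
    -- the sum removes `n t`.
    S²+S : ∀ j → S j * S j + S j ≈ frob (j ℕ.* 1) n * tr 1 j D + D * frob 1 (tr 1 j n)
    S²+S zero    = begin
      0# * 0# + 0#                    ≈⟨ solve 2 (λ n d → con false :* con false :+ con false := n :* :1 :* con false :+ d :* (con false :* (con false :* :1))) refl n D ⟩
      frob 0 n * 0# + D * frob 1 0#   ∎
    S²+S (suc j) = begin
      (S j + f * P) * (S j + f * P) + (S j + f * P)          ≈⟨ solve 3 (λ s f p → (s :+ f :* p) :* (s :+ f :* p) :+ (s :+ f :* p) := (s :* s :+ s) :+ (f :* f :* (p :* p) :+ f :* p)) refl (S j) f P ⟩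
      (S j * S j + S j) + (f * f * (P * P) + f * P)          ≈⟨ +-congʳ (S²+S j) ⟩
      (f * P + D * frob 1 T) + (f * f * (P * P) + f * P)     ≈⟨ solve 4 (λ f p d r → (f :* p :+ d :* r) :+ (f :* f :* (p :* p) :+ f :* p) := f :* f :* (d :+ p :* p) :+ d :* (r :+ f :* f)) refl f P D (frob 1 T) ⟩
      f * f * (D + P * P) + D * (frob 1 T + f * f)           ≈⟨ +-cong (*-cong (frob-suc (j ℕ.* 1) n) (+-congˡ (frob₁ P)))
                                                                       (*-congˡ (trans (frob-cong 1 (tr-suc 1 j n)) (trans (frob-+ 1 T f) (+-congˡ (frob₁ f))))) ⟨
      frob (suc j ℕ.* 1) n * tr 1 (suc j) D + D * frob 1 (tr 1 (suc j) n)  ∎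
      where
      f = frob (j ℕ.* 1) n
      P = tr 1 j D
      T = tr 1 j n

  frob-root : ∀ j {ζ D} → ζ * ζ + ζ ≈ D → frob j ζ * frob j ζ + frob j ζ ≈ frob j D
  frob-root j {ζ} ζ²+ζ = trans (trans (+-congʳ (sym (frob-* j ζ ζ))) (sym (frob-+ j _ _))) (frob-cong j ζ²+ζ)

  -- `ζ` and `ζ̄` are roots of the same equation `X² + X = D`, so their sum is a root of `X² + X`.
  conjugate-root : ∀ {ζ D} → Fixed k D → ζ * ζ + ζ ≈ D → (ζ + bar ζ) * (ζ + bar ζ) ≈ ζ + bar ζ
  conjugate-root {ζ} {D} fD ζ²+ζ = x+y≈0⇒x≈y (begin
    (ζ + bar ζ) * (ζ + bar ζ) + (ζ + bar ζ)    ≈⟨ solve 2 (λ x y → (x :+ y) :* (x :+ y) :+ (x :+ y) := (x :* x :+ x) :+ (y :* y :+ y)) refl ζ (bar ζ) ⟩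
    (ζ * ζ + ζ) + (bar ζ * bar ζ + bar ζ)      ≈⟨ +-cong ζ²+ζ (trans (frob-root k ζ²+ζ) fD) ⟩
    D + D                                      ≈⟨ x+x≈0 D ⟩
    0#                                         ∎)

  module _ (i k′ j : ℕ) (k≡ : k ≡ k′ ℕ.* i) (l≡ : l ≡ suc (j ℕ.* 2) ℕ.* i) where

    private
      Tr : Carrier → Carrier
      Tr = tr i k′

      frob-Tr : ∀ x → frob i (Tr x) + Tr x ≈ bar x + x
      frob-Tr x = trans (tr-telescope i k′ x) (+-congʳ (^-congʳ x (≡.cong (2 ℕ.^_) (≡.sym k≡))))

      frob-Tr′ : ∀ {x s} → bar x ≈ x + s → frob i (Tr x) ≈ Tr x + s
      frob-Tr′ {x} {s} x̄ = begin
        frob i (Tr x)                    ≈⟨ solve 2 (λ p t → p := t :+ (p :+ t)) refl (frob i (Tr x)) (Tr x) ⟩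
        Tr x + (frob i (Tr x) + Tr x)    ≈⟨ +-congˡ (trans (frob-Tr x) (+-congʳ x̄)) ⟩
        Tr x + (x + s + x)               ≈⟨ solve 3 (λ t x s → t :+ (x :+ s :+ x) := t :+ s) refl (Tr x) x s ⟩
        Tr x + s                         ∎

      -- σ is an odd power of x ↦ x^(2^i).
      σ-shift : ∀ {x s} → Fixed i s → frob i x ≈ x + s → σ x ≈ x + s
      σ-shift {x} {s} fs φx = begin
        σ x                              ≈⟨ ^-congʳ x (≡.cong (2 ℕ.^_) l≡) ⟩
        frob (suc (j ℕ.* 2) ℕ.* i) x     ≈⟨ frob-iterate i (suc (j ℕ.* 2)) φx ⟩
        x + tr i (suc (j ℕ.* 2)) s       ≈⟨ +-congˡ (tr-odd i j fs) ⟩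
        x + s                            ∎

      Tr-σ : ∀ x → Tr (σ x + x) ≈ σ (Tr x) + Tr x
      Tr-σ x = trans (tr-+ i k′ _ _) (+-congʳ (tr-frob i k′ l x))

      -- `Tr` commutes with `σ`, so the left side is the displacement of `Tr x` under `σ`. One step
      -- of `frob i` displaces `Tr x` by `s`, and an odd number of steps again by `s`.
      Tr-σ′ : ∀ {x s} → Fixed i s → bar x ≈ x + s → Tr (σ x + x) ≈ s
      Tr-σ′ {x} {s} fs x̄ = begin
        Tr (σ x + x)         ≈⟨ Tr-σ x ⟩
        σ (Tr x) + Tr x      ≈⟨ +-congʳ (σ-shift fs (frob-Tr′ x̄)) ⟩
        Tr x + s + Tr x      ≈⟨ solve 2 (λ t s → t :+ s :+ t := s) refl (Tr x) s ⟩
        s                    ∎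

      fixed-i-0 : Fixed i 0#
      fixed-i-0 = 0^n≈0 (2 ℕ.^ i) {{ℕ.m^n≢0 2 i}}

    σ+1⇒Tr≈1 : ∀ {ζ c} → bar ζ ≈ ζ + 1# → σ ζ + ζ ≈ c → Tr c ≈ 1#
    σ+1⇒Tr≈1 ζ̄ σζ = trans (tr-cong i k′ (sym σζ)) (Tr-σ′ (frob-1 i) ζ̄)

    -- A root `ζ₀` of `X² + X = D` is corrected. Its displacement `A` under conjugation and its
    -- defect `B` under `σ` lie in F₂, the first because `D` is in F_q, the second because
    -- `σ D + D = c² + c`. Adding `B ω` repairs the defect, as `σ ω = ω + 1`, and changes `A` by
    -- `B κ`. The trace of `B` gives `B κ = A + Tr c = A + 1`, exactly the change that conjugation
    -- needs.
    Tr≉0⇒σ+1 : ∀ {D c} → Fixed k D → σ D + D ≈ c * c + c → ¬ (Tr c ≈ 0#) →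
               ∃ λ ζ → bar ζ ≈ ζ + 1# × σ ζ + ζ ≈ c
    Tr≉0⇒σ+1 {D} {c} fD σD Trc≉0 = ζ₀ + B * ω , conj , shift
      where
      z = proj₁ affine-point
      ζ₀ = proj₁ (artin-schreier fD)
      ζ₀²+ζ₀ = proj₂ (artin-schreier fD)
      A = ζ₀ + bar ζ₀
      B = σ ζ₀ + ζ₀ + c
      ω = Tr z
      κ = Tr 1#

      -- `c² + c = σ D + D` has trace 0, so `Tr c` lies in F₂ and nonzero means 1.
      t²≈t : Tr c * Tr c ≈ Tr c
      t²≈t = x+y≈0⇒x≈y (begin
        Tr c * Tr c + Tr c         ≈⟨ +-congʳ (frob₁ (Tr c)) ⟨
        frob 1 (Tr c) + Tr c       ≈⟨ +-congʳ (tr-frob i k′ 1 c) ⟨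
        Tr (frob 1 c) + Tr c       ≈⟨ tr-+ i k′ _ _ ⟨
        Tr (frob 1 c + c)          ≈⟨ tr-cong i k′ (trans (+-congʳ (frob₁ c)) (sym σD)) ⟩
        Tr (σ D + D)               ≈⟨ Tr-σ′ fixed-i-0 (trans fD (sym (+-identityʳ D))) ⟩
        0#                         ∎)

      Trc≈1 : Tr c ≈ 1#
      Trc≈1 = [ (λ Trc≈0 → ⊥-elim (Trc≉0 Trc≈0)) , (λ Trc≈1 → Trc≈1) ]′ (idempotent⇒0∨1 (Tr c ≟ 0#) t²≈t)

      A²≈A : A * A ≈ A
      A²≈A = conjugate-root fD ζ₀²+ζ₀

      B²≈B : B * B ≈ B
      B²≈B = x+y≈0⇒x≈y (begin
        B * B + B                                           ≈⟨ solve 3 (λ x y c → (x :+ y :+ c) :* (x :+ y :+ c) :+ (x :+ y :+ c) := (x :* x :+ x) :+ (y :* y :+ y) :+ (c :* c :+ c)) refl (σ ζ₀) ζ₀ c ⟩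
        (σ ζ₀ * σ ζ₀ + σ ζ₀) + (ζ₀ * ζ₀ + ζ₀) + (c * c + c)  ≈⟨ +-cong (+-cong (frob-root l ζ₀²+ζ₀) ζ₀²+ζ₀) (sym σD) ⟩
        (σ D + D) + (σ D + D)                               ≈⟨ x+x≈0 _ ⟩
        0#                                                  ∎)

      ω̄ : bar ω ≈ ω + κ
      ω̄ = trans (^-congʳ ω (≡.cong (2 ℕ.^_) k≡)) (frob-iterate i k′ (frob-Tr′ (proj₂ affine-point)))

      σω : σ ω ≈ ω + 1#
      σω = σ-shift (frob-1 i) (frob-Tr′ (proj₂ affine-point))

      Bκ≈A+1 : B * κ ≈ A + 1#
      Bκ≈A+1 = begin
        B * Tr 1#               ≈⟨ tr-scale i k′ 1# (idempotent⇒fixed i B²≈B) ⟨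
        Tr (B * 1#)             ≈⟨ tr-cong i k′ (*-identityʳ B) ⟩
        Tr (σ ζ₀ + ζ₀ + c)      ≈⟨ tr-+ i k′ _ _ ⟩
        Tr (σ ζ₀ + ζ₀) + Tr c   ≈⟨ +-cong (Tr-σ′ (idempotent⇒fixed i A²≈A) (solve 2 (λ x y → y := x :+ (x :+ y)) refl ζ₀ (bar ζ₀))) Trc≈1 ⟩
        A + 1#                  ∎

      conj : bar (ζ₀ + B * ω) ≈ ζ₀ + B * ω + 1#
      conj = begin
        bar (ζ₀ + B * ω)             ≈⟨ trans (frob-+ k _ _) (+-congˡ (frob-* k B ω)) ⟩
        bar ζ₀ + bar B * bar ω       ≈⟨ +-congˡ (*-cong (idempotent⇒fixed k B²≈B) ω̄) ⟩
        bar ζ₀ + B * (ω + κ)         ≈⟨ +-congˡ (trans (distribˡ B ω κ) (+-congˡ Bκ≈A+1)) ⟩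
        bar ζ₀ + (B * ω + (A + 1#))  ≈⟨ solve 3 (λ x y w → y :+ (w :+ (x :+ y :+ :1)) := x :+ w :+ :1) refl ζ₀ (bar ζ₀) (B * ω) ⟩
        ζ₀ + B * ω + 1#              ∎

      shift : σ (ζ₀ + B * ω) + (ζ₀ + B * ω) ≈ c
      shift = begin
        σ (ζ₀ + B * ω) + (ζ₀ + B * ω)             ≈⟨ +-congʳ (trans (frob-+ l _ _) (+-congˡ (frob-* l B ω))) ⟩
        σ ζ₀ + σ B * σ ω + (ζ₀ + B * ω)           ≈⟨ +-congʳ (+-congˡ (*-cong (idempotent⇒fixed l B²≈B) σω)) ⟩
        σ ζ₀ + B * (ω + 1#) + (ζ₀ + B * ω)        ≈⟨ solve 4 (λ s x c w → s :+ (s :+ x :+ c) :* (w :+ :1) :+ (x :+ (s :+ x :+ c) :* w) := c) refl (σ ζ₀) ζ₀ c ω ⟩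
        c                                         ∎

-- Hermite's criterion for the binomial M

module Hermite (F : Field c ℓ) (k l : ℕ) .{{_ : NonZero k}} .{{_ : NonZero l}}
               (enumeration : HasOrder F (2 ℕ.^ (k ℕ.* 2))) where
  open Field F hiding (zero)
  open Lines F k l enumeration
  open PowersOfOne F
  open ≈-Reasoning setoid
  open ℕ-Arithmetic using (UniqueRoot; unique-root; q+1∣1+Qj; 1+[q∸1]r<q*q)
  open SemiringSum semiring using (*-distribˡ-sum; sum-cong-≋; ∑-comm)
  open Bijection enumeration using (to)

  geometric-sum : ∀ n x → (1# + x) * sum {n} (λ i → x ^ toℕ i) ≈ 1# + x ^ n
  geometric-sum zero    x = trans (zeroʳ _) (sym 1+1≈0)
  geometric-sum (suc n) x = begin
    (1# + x) * (1# + sum {n} (λ i → x * x ^ toℕ i))   ≈⟨ *-congˡ (+-congˡ (*-distribˡ-sum {n} x (λ i → x ^ toℕ i))) ⟨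
    (1# + x) * (1# + x * S)                           ≈⟨ solve 2 (λ x s → (:1 :+ x) :* (:1 :+ x :* s) := :1 :+ x :+ x :* ((:1 :+ x) :* s)) refl x S ⟩
    1# + x + x * ((1# + x) * S)                       ≈⟨ +-congˡ (*-congˡ (geometric-sum n x)) ⟩
    1# + x + x * (1# + x ^ n)                         ≈⟨ solve 2 (λ x s → :1 :+ x :+ x :* (:1 :+ s) := :1 :+ x :* s) refl x (x ^ n) ⟩
    1# + x * x ^ n                                    ∎
    where S = sum {n} (λ i → x ^ toℕ i)

  nonZero-q∸1 : NonZero (q ∸ 1)
  nonZero-q∸1 = ℕ.>-nonZero (ℕ.m<n⇒0<n∸m 2≤q)

  -- Reduce `n` modulo `q + 1`. A nonzero remainder `r ≤ q` would make every nonzero element a root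
  -- of unity of exponent `(q - 1) r < q² - 1`, more roots than the degree allows.
  exponent-∣ : ∀ n → (∀ y → ¬ (y ≈ 0#) → y ^ ((q ∸ 1) ℕ.* n) ≈ 1#) → suc q ∣ n
  exponent-∣ n all with n % suc q in eq
  ... | zero  = ∣.m%n≡0⇒n∣m n (suc q) eq
  ... | suc r = ⊥-elim (¬all-roots-of-unity (ℕ.pred e) bound (λ y y≉0 → begin
      y ^ suc (ℕ.pred e)              ≈⟨ ^-congʳ y (ℕ.suc-pred e) ⟩
      y ^ e                           ≈⟨ ^-assocʳ y (q ∸ 1) (suc r) ⟨
      (y ^ (q ∸ 1)) ^ suc r           ≈⟨ ^-congʳ (y ^ (q ∸ 1)) eq ⟨
      (y ^ (q ∸ 1)) ^ (n % suc q)     ≈⟨ ^-% (suc q) ([x^[q∸1]]^[1+q]≈1 y≉0) n ⟨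
      (y ^ (q ∸ 1)) ^ n               ≈⟨ ^-assocʳ y (q ∸ 1) n ⟩
      y ^ ((q ∸ 1) ℕ.* n)             ≈⟨ all y y≉0 ⟩
      1#                              ∎))
    where
    e = (q ∸ 1) ℕ.* suc r
    instance
      nonZero-e : NonZero e
      nonZero-e = ℕ.m*n≢0 (q ∸ 1) (suc r) {{nonZero-q∸1}}
    bound : 2 ℕ.+ ℕ.pred e < 2 ℕ.^ (k ℕ.* 2)
    bound = ≡.subst₂ _<_ (≡.cong suc (≡.sym (ℕ.suc-pred e))) (≡.trans (≡.cong (q ℕ.*_) (≡.sym (ℕ.*-identityʳ q))) (ℕ.^-*-assoc 2 k 2))
      (1+[q∸1]r<q*q q (suc r) 2≤q (ℕ.s≤s⁻¹ (≡.subst (_< suc q) eq (m%n<n n (suc q)))))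

  module _ (C : Carrier) (fC : Fixed k C) where

    M : Carrier → Carrier
    M z = z * (C * σ z + (1# + C) * σ (bar z))

    M-cong : Congruent _≈_ _≈_ M
    M-cong z≈w = *-cong z≈w (+-cong (*-congˡ (frob-cong l z≈w)) (*-congˡ (frob-cong l (frob-cong k z≈w))))

    M-scale : ∀ {s} → Fixed k s → ∀ z → M (s * z) ≈ (s * σ s) * M z
    M-scale {s} fs z = begin
      M (s * z)                                                              ≈⟨ *-congˡ (+-cong (*-congˡ (frob-* l s z)) (*-congˡ (trans (frob-cong l (trans (frob-* k s z) (*-congʳ fs))) (frob-* l s (bar z))))) ⟩
      s * z * (C * (σ s * σ z) + (1# + C) * (σ s * σ (bar z)))               ≈⟨ solve 6 (λ s t z C Z B → s :* z :* (C :* (t :* Z) :+ (:1 :+ C) :* (t :* B)) := s :* t :* (z :* (C :* Z :+ (:1 :+ C) :* B))) refl s (σ s) z C (σ z) _ ⟩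
      (s * σ s) * M z                                                        ∎

    module M-lines = Homogeneous M-cong M-scale

    -- Hermite's criterion with exponent q - 1: on M z ≠ 0, (M z)^(q-1) = M̄/M = y (y^Q + b)/(1 + b y^Q) with
    -- y = z^(q-1) and b = (1 + C)/C, a polynomial in y in which exactly one exponent is divisible by q + 1.
    ¬M-separates : ¬ (C ≈ 0#) → ¬ (1# + C ≈ 0#) → UniqueRoot q Q → ¬ M-lines.SeparatesLines
    ¬M-separates C≉0 1+C≉0 (i₀ , ∣.divides t q+1∣ , unique) separates = ^-≉0 (toℕ i₀) b≉0 (begin
      b ^ toℕ i₀                                              ≈⟨ *-identityʳ _ ⟨
      b ^ toℕ i₀ * 1#                                         ≈⟨ *-congˡ divisible-sum ⟨
      summand i₀                                              ≈⟨ sum-supported-at +-commutativeMonoid summand i₀ vanishing ⟨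
      sum summand                                             ≈⟨ exchange ⟩
      ∑ (λ z → sum {q} (λ i → b ^ toℕ i * z ^ exponent i))    ≈⟨ sum-cong-≋ (λ x → expansion (to x)) ⟨
      ∑ (λ z → M-lines.reduced z ^ (q ∸ 1))                   ≈⟨ sum-reindex M-lines.reduced-cong (M-lines.separates⇒injective separates) +-commutativeMonoid (^-congˡ (q ∸ 1)) ⟩
      ∑ (_^ (q ∸ 1))                                          ≈⟨ total ⟩
      0#                                                      ∎)
      where
      C⁻¹ = inv C C≉0
      CC⁻¹≈1 = proj₂ (invertible C C≉0)
      b = (1# + C) * C⁻¹

      b≉0 : ¬ (b ≈ 0#)
      b≉0 = *-≉0 1+C≉0 (inverse-≉0 CC⁻¹≈1)

      Cb≈1+C : C * b ≈ 1# + C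
      Cb≈1+C = trans (solve 2 (λ C D → C :* ((:1 :+ C) :* D) := (:1 :+ C) :* (C :* D)) refl C C⁻¹) (trans (*-congˡ CC⁻¹≈1) (*-identityʳ _))

      fb : Fixed k b
      fb = fixed-* k (fixed-+ k (frob-1 k) fC) (fixed-inverse k CC⁻¹≈1 fC)

      exponent : Fin q → ℕ
      exponent i = (q ∸ 1) ℕ.* (1 ℕ.+ Q ℕ.* suc (toℕ i))

      nonZero-exponent : ∀ i → NonZero (exponent i)
      nonZero-exponent i = ℕ.m*n≢0 (q ∸ 1) _ {{nonZero-q∸1}}

      suc-q∤1 : ¬ (suc q ∣ 1)
      suc-q∤1 m∣1 = ℕ.1+n≰n (ℕ.≤-trans (s≤s (ℕ.m^n>0 2 k)) (ℕ.≤-reflexive (∣.∣1⇒≡1 m∣1)))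

      root-of-unity : ∀ {y} → ¬ (y ≈ 0#) → (y ^ (q ∸ 1)) ^ (1 ℕ.+ Q ℕ.* suc (toℕ i₀)) ≈ 1#
      root-of-unity {y} y≉0 = trans (^-congʳ (y ^ (q ∸ 1)) q+1∣) (^-multiple≈1 (suc q) ([x^[q∸1]]^[1+q]≈1 y≉0) t)

      summand : Fin q → Carrier
      summand i = b ^ toℕ i * ∑ (_^ exponent i)

      divisible-sum : ∑ (_^ exponent i₀) ≈ 1#
      divisible-sum = power-sum≈1 (exponent i₀) {{nonZero-exponent i₀}}
        (λ y y≉0 → trans (sym (^-assocʳ y (q ∸ 1) (1 ℕ.+ Q ℕ.* suc (toℕ i₀)))) (root-of-unity y≉0))

      vanishing : ∀ i → i ≢ i₀ → summand i ≈ 0#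
      vanishing i i≢i₀ = trans (*-congˡ (power-sum≈0 (exponent i)
        (λ all → i≢i₀ (unique i (exponent-∣ (1 ℕ.+ Q ℕ.* suc (toℕ i)) all))))) (zeroʳ _)

      exchange : sum summand ≈ ∑ (λ z → sum {q} (λ i → b ^ toℕ i * z ^ exponent i))
      exchange = trans (sum-cong-≋ {q} (λ i → *-distribˡ-sum {2 ℕ.^ (k ℕ.* 2)} (b ^ toℕ i) (λ x → to x ^ exponent i)))
        (∑-comm {q} (λ i x → b ^ toℕ i * to x ^ exponent i))

      total : ∑ (_^ (q ∸ 1)) ≈ 0#
      total = power-sum≈0 (q ∸ 1) (λ all → suc-q∤1
        (exponent-∣ 1 (λ y y≉0 → trans (^-congʳ y (ℕ.*-identityʳ (q ∸ 1))) (all y y≉0))))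

      expansion : ∀ z → M-lines.reduced z ^ (q ∸ 1) ≈ sum {q} (λ i → b ^ toℕ i * z ^ exponent i)
      expansion z with z ≟ 0#
      ... | yes z≈0 = begin
        M-lines.reduced z ^ (q ∸ 1)                ≈⟨ trans (^-congˡ (q ∸ 1) (M-lines.reduced-zero z≈0)) (0^n≈0 (q ∸ 1) {{nonZero-q∸1}}) ⟩
        0#                                         ≈⟨ sum-zero q ⟨
        sum {q} (λ i → 0#)                         ≈⟨ sum-cong-≋ {q} (λ i → trans (*-congˡ (trans (^-congˡ (exponent i) z≈0) (0^n≈0 (exponent i) {{nonZero-exponent i}}))) (zeroʳ _)) ⟨
        sum {q} (λ i → b ^ toℕ i * z ^ exponent i) ∎
        where open SemiringSum semiring using () renaming (sum-replicate-zero to sum-zero)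
      ... | no z≉0 = begin
        (norm z ^ J * M z) ^ (q ∸ 1)               ≈⟨ ^-distrib-* _ _ (q ∸ 1) ⟩
        (norm z ^ J) ^ (q ∸ 1) * M z ^ (q ∸ 1)     ≈⟨ *-congʳ (fixed^[q∸1]≈1 (^-≉0 J (norm-≉0 z≉0)) (fixed-^ J (fixed-norm z))) ⟩
        1# * M z ^ (q ∸ 1)                         ≈⟨ *-identityˡ _ ⟩
        M z ^ (q ∸ 1)                              ≈⟨ *-cancelˡ-≉0 (M-lines.G-≉0 separates z≉0) (trans (x*x^[q∸1] (M z)) (sym M*series)) ⟩
        y * Y * sum {q} (λ i → (b * Y) ^ toℕ i)     ≈⟨ *-distribˡ-sum {q} (y * Y) (λ i → (b * Y) ^ toℕ i) ⟩
        sum {q} (λ i → y * Y * (b * Y) ^ toℕ i)     ≈⟨ sum-cong-≋ {q} term ⟩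
        sum {q} (λ i → b ^ toℕ i * z ^ exponent i)  ∎
        where
        y = z ^ (q ∸ 1)
        Y = σ y

        term : ∀ (i : Fin q) → y * Y * (b * Y) ^ toℕ i ≈ b ^ toℕ i * z ^ exponent i
        term i = begin
          y * Y * (b * Y) ^ toℕ i                    ≈⟨ *-congˡ (^-distrib-* b Y (toℕ i)) ⟩
          y * Y * (b ^ toℕ i * Y ^ toℕ i)            ≈⟨ solve 4 (λ y Y b Z → y :* Y :* (b :* Z) := b :* (y :* (Y :* Z))) refl y Y _ _ ⟩
          b ^ toℕ i * (y * Y ^ suc (toℕ i))          ≈⟨ *-congˡ (*-congˡ (^-assocʳ y Q (suc (toℕ i)))) ⟩
          b ^ toℕ i * y ^ (1 ℕ.+ Q ℕ.* suc (toℕ i))  ≈⟨ *-congˡ (^-assocʳ z (q ∸ 1) (1 ℕ.+ Q ℕ.* suc (toℕ i))) ⟩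
          b ^ toℕ i * z ^ exponent i                 ∎

        zy≈z̄ : z * y ≈ bar z
        zy≈z̄ = x*x^[q∸1] z

        ZY≈Z̄ : σ z * Y ≈ σ (bar z)
        ZY≈Z̄ = trans (sym (frob-* l z y)) (frob-cong l zy≈z̄)

        Z̄Y̅≈Z : σ z * Y * bar Y ≈ σ z
        Z̄Y̅≈Z = begin
          σ z * Y * bar Y            ≈⟨ *-cong ZY≈Z̄ (frob-comm k l y) ⟩
          σ (bar z) * σ (bar y)      ≈⟨ frob-* l _ _ ⟨
          σ (bar z * bar y)          ≈⟨ frob-cong l (trans (sym (frob-* k z y)) (trans (frob-cong k zy≈z̄) (bar-involutive z))) ⟩
          σ z                        ∎

        series = sum {q} (λ i → (b * Y) ^ toℕ i)

        -- The series has exactly `q` terms, so `(1 + b Y) * series = 1 + (b Y)^q = 1 + b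
        -- Ȳ`: the quotient by `1 + b Y` becomes a polynomial.
        M*series : M z * (y * Y * series) ≈ bar (M z)
        M*series = begin
          z * (C * σ z + (1# + C) * σ (bar z)) * (y * Y * series)              ≈⟨ *-congʳ (*-congˡ (+-congˡ (*-cong Cb≈1+C ZY≈Z̄))) ⟨
          z * (C * σ z + (C * b) * (σ z * Y)) * (y * Y * series)               ≈⟨ solve 7 (λ z C Z b Y y s → z :* (C :* Z :+ (C :* b) :* (Z :* Y)) :* (y :* Y :* s) := (z :* y) :* C :* (Z :* Y) :* ((:1 :+ b :* Y) :* s)) refl z C (σ z) b Y y series ⟩
          (z * y) * C * (σ z * Y) * ((1# + b * Y) * series)                    ≈⟨ *-congˡ (geometric-sum q (b * Y)) ⟩
          (z * y) * C * (σ z * Y) * (1# + bar (b * Y))                         ≈⟨ *-congˡ (+-congˡ (trans (frob-* k b Y) (*-congʳ fb))) ⟩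
          (z * y) * C * (σ z * Y) * (1# + b * bar Y)                           ≈⟨ solve 5 (λ t C Z b B → t :* C :* Z :* (:1 :+ b :* B) := t :* (C :* Z :+ C :* b :* (Z :* B))) refl (z * y) C (σ z * Y) b (bar Y) ⟩
          (z * y) * (C * (σ z * Y) + C * b * (σ z * Y * bar Y))                ≈⟨ *-cong zy≈z̄ (+-cong (*-congˡ ZY≈Z̄) (*-cong Cb≈1+C Z̄Y̅≈Z)) ⟩
          bar z * (C * σ (bar z) + (1# + C) * σ z)                             ≈⟨ *-congˡ (+-cong (*-cong fC (frob-comm k l z))
               (*-cong (fixed-+ k (frob-1 k) fC) (trans (frob-comm k l (bar z)) (frob-cong l (bar-involutive z))))) ⟨
          bar z * (bar C * bar (σ z) + bar (1# + C) * bar (σ (bar z)))         ≈⟨ *-congˡ (trans (frob-+ k _ _) (+-cong (frob-* k _ _) (frob-* k _ _))) ⟨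
          bar z * bar (C * σ z + (1# + C) * σ (bar z))                         ≈⟨ frob-* k z _ ⟨
          bar (M z)                                                            ∎

-- Separation of lines by N in terms of D and ε

module Criterion (F : Field c ℓ) (k l : ℕ) .{{_ : NonZero k}} .{{_ : NonZero l}}
                 (enumeration : HasOrder F (2 ℕ.^ (k ℕ.* 2))) where
  open Field F hiding (zero)
  open Traces F k l enumeration public
  open Hermite F k l enumeration using (M; module M-lines; ¬M-separates)
  open ≈-Reasoning setoid
  open ℕ-Arithmetic using (unique-root; q+1∣1+Qj)

  -- D = d/e and ε = 1/(1 + a + d); then a/e = D + ε + ε², so both conditions are expressed through D and ε.
  module _ {a d ε : Carrier} (fa : Fixed k a) (fd : Fixed k d) (Eε≈1 : (1# + a + d) * ε ≈ 1#) where

    D D′ : Carrier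
    D = d * (ε * ε)
    D′ = D + ε + ε * ε

    private
      fε : Fixed k ε
      fε = fixed-inverse k Eε≈1 (fixed-+ k (fixed-+ k (frob-1 k) fa) fd)

      ε≉0 : ¬ (ε ≈ 0#)
      ε≉0 = inverse-≉0 Eε≈1

    fixed-D : Fixed k D
    fixed-D = fixed-* k fd (fixed-* k fε fε)

    aε²≈D′ : a * (ε * ε) ≈ D′
    aε²≈D′ = begin
      a * (ε * ε)                                   ≈⟨ solve 3 (λ a d ε → a :* (ε :* ε) := d :* (ε :* ε) :+ ((:1 :+ a :+ d) :* ε) :* ε :+ ε :* ε) refl a d ε ⟩
      D + ((1# + a + d) * ε) * ε + ε * ε             ≈⟨ +-congʳ (+-congˡ (trans (*-congʳ Eε≈1) (*-identityˡ ε))) ⟩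
      D + ε + ε * ε                                 ∎

    form′ : Carrier → Carrier → Carrier → Carrier → Carrier
    form′ X X̄ y ȳ = D * (X * y) + ε * ε * (X * ȳ) + D′ * (X̄ * ȳ)

    ε²*form : ∀ X X̄ y ȳ → ε * ε * form a d X X̄ y ȳ ≈ form′ X X̄ y ȳ
    ε²*form X X̄ y ȳ = begin
      ε * ε * (d * (X * y) + X * ȳ + a * (X̄ * ȳ))                         ≈⟨ solve 6 (λ a d ε p q r → ε :* ε :* (d :* p :+ q :+ a :* r) := d :* (ε :* ε) :* p :+ ε :* ε :* q :+ a :* (ε :* ε) :* r) refl a d ε (X * y) (X * ȳ) (X̄ * ȳ) ⟩
      D * (X * y) + ε * ε * (X * ȳ) + a * (ε * ε) * (X̄ * ȳ)               ≈⟨ +-congˡ (*-congʳ aε²≈D′) ⟩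
      form′ X X̄ y ȳ                                                        ∎

    det′ : (Z Z̄ z z̄ W W̄ w w̄ : Carrier) → Carrier
    det′ Z Z̄ z z̄ W W̄ w w̄ = form′ Z Z̄ z z̄ * form′ W̄ W w̄ w + form′ Z̄ Z z̄ z * form′ W W̄ w w̄

    det-N : ∀ z w → ε * ε * (ε * ε) * det (N a d z) (N a d w) ≈ det′ (σ z) (σ (bar z)) z (bar z) (σ w) (σ (bar w)) w (bar w)
    det-N z w = begin
      ε * ε * (ε * ε) * (N a d z * bar (N a d w) + bar (N a d z) * N a d w)
        ≈⟨ *-congˡ (+-cong (*-congˡ (bar-N a d fa fd w)) (*-congʳ (bar-N a d fa fd z))) ⟩
      ε * ε * (ε * ε) * (N a d z * w′ + z′ * N a d w)
        ≈⟨ solve 5 (λ e p q r s → e :* e :* (p :* q :+ r :* s) := (e :* p) :* (e :* q) :+ (e :* r) :* (e :* s)) refl (ε * ε) _ _ _ _ ⟩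
      (ε * ε * N a d z) * (ε * ε * w′) + (ε * ε * z′) * (ε * ε * N a d w)
        ≈⟨ +-cong (*-cong (ε²*form _ _ _ _) (ε²*form _ _ _ _)) (*-cong (ε²*form _ _ _ _) (ε²*form _ _ _ _)) ⟩
      det′ (σ z) (σ (bar z)) z (bar z) (σ w) (σ (bar w)) w (bar w) ∎
      where
      z′ = form a d (σ (bar z)) (σ z) (bar z) z
      w′ = form a d (σ (bar w)) (σ w) (bar w) w

    det′≈0⇒det-N≈0 : ∀ z w → det′ (σ z) (σ (bar z)) z (bar z) (σ w) (σ (bar w)) w (bar w) ≈ 0# → det (N a d z) (N a d w) ≈ 0#
    det′≈0⇒det-N≈0 z w eq = *-cancelˡ-0 (*-≉0 (*-≉0 ε≉0 ε≉0) (*-≉0 ε≉0 ε≉0)) (trans (det-N z w) eq)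

    det-N≈0⇒det′≈0 : ∀ z w → det (N a d z) (N a d w) ≈ 0# → det′ (σ z) (σ (bar z)) z (bar z) (σ w) (σ (bar w)) w (bar w) ≈ 0#
    det-N≈0⇒det′≈0 z w eq = trans (sym (det-N z w)) (trans (*-congˡ eq) (zeroʳ _))

    det′-cong : ∀ {Z Z₁ Z̄ Z̄₁ z z₁ z̄ z̄₁ W W₁ W̄ W̄₁ w w₁ w̄ w̄₁} → Z ≈ Z₁ → Z̄ ≈ Z̄₁ → z ≈ z₁ → z̄ ≈ z̄₁ →
                W ≈ W₁ → W̄ ≈ W̄₁ → w ≈ w₁ → w̄ ≈ w̄₁ → det′ Z Z̄ z z̄ W W̄ w w̄ ≈ det′ Z₁ Z̄₁ z₁ z̄₁ W₁ W̄₁ w₁ w̄₁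
    det′-cong Z Z̄ z z̄ W W̄ w w̄ = +-cong (*-cong (form′-cong Z Z̄ z z̄) (form′-cong W̄ W w̄ w)) (*-cong (form′-cong Z̄ Z z̄ z) (form′-cong W W̄ w w̄))
      where
      form′-cong : ∀ {X X₁ X̄ X̄₁ y y₁ ȳ ȳ₁} → X ≈ X₁ → X̄ ≈ X̄₁ → y ≈ y₁ → ȳ ≈ ȳ₁ → form′ X X̄ y ȳ ≈ form′ X₁ X̄₁ y₁ ȳ₁
      form′-cong X X̄ y ȳ = +-cong (+-cong (*-congˡ (*-cong X y)) (*-congˡ (*-cong X ȳ))) (*-congˡ (*-cong X̄ ȳ))

    -- Sorted by `L = det z w`, its `Q`-analogue, and the expressions whose quotients by these are
    -- the sought `ζ` and its image. `D′` is not assumed to be `σ D`, so the identity holds with or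
    -- without condition (2).
    det′-formula : ∀ Z Z̄ z z̄ W W̄ w w̄ → det′ Z Z̄ z z̄ W W̄ w w̄ ≈
      ε * ε * ((Z * W̄ + D′ * ((Z + Z̄) * (W + W̄))) * (z * w̄ + z̄ * w) + (z * w̄ + D * ((z + z̄) * (w + w̄))) * (Z * W̄ + Z̄ * W) + (1# + ε) * ((z * w̄ + z̄ * w) * (Z * W̄ + Z̄ * W)))
    det′-formula = solve 10 (λ D i Z Zb z zb W Wb w wb →
      let D′ = D :+ i :+ i :* i
          N = λ X Xb y yb → D :* (X :* y) :+ i :* i :* (X :* yb) :+ D′ :* (Xb :* yb)
          L = z :* wb :+ zb :* w
          LQ = Z :* Wb :+ Zb :* W
      in N Z Zb z zb :* N Wb W wb w :+ N Zb Z zb z :* N W Wb w wb :=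
         i :* i :* ((Z :* Wb :+ D′ :* ((Z :+ Zb) :* (W :+ Wb))) :* L :+ (z :* wb :+ D :* ((z :+ zb) :* (w :+ wb))) :* LQ :+ (:1 :+ i) :* (L :* LQ)))
      refl D ε

    -- For `w = 1` the terms with `D` and `D′` in `det′-formula` drop out and both small
    -- determinants are 1; what remains is `ε² (σ ζ + ζ + 1 + ε) = 0`. Yet `det ζ 1 = ζ + ζ̄ = 1`.
    σ+1⇒¬separates : ∀ {ζ} → bar ζ ≈ ζ + 1# → σ ζ + ζ ≈ 1# + ε → ¬ SeparatesLines a d
    σ+1⇒¬separates {ζ} ζ̄ σζ separates = 1≉0 (begin
      1#                       ≈⟨ solve 1 (λ ζ → :1 := ζ :* :1 :+ (ζ :+ :1) :* :1) refl ζ ⟩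
      ζ * 1# + (ζ + 1#) * 1#   ≈⟨ +-cong (*-congˡ (frob-1 k)) (*-congʳ ζ̄) ⟨
      det ζ 1#                 ≈⟨ separates ζ 1# (det′≈0⇒det-N≈0 ζ 1# (trans (det′-cong σζ′ σζ̄ refl ζ̄ (frob-1 l) (trans (frob-cong l (frob-1 k)) (frob-1 l)) refl (frob-1 k)) identity)) ⟩
      0#                       ∎)
      where
      σζ′ : σ ζ ≈ ζ + (1# + ε)
      σζ′ = trans (solve 2 (λ s z → s := z :+ (s :+ z)) refl (σ ζ) ζ) (+-congˡ σζ)
      σζ̄ : σ (bar ζ) ≈ ζ + ε
      σζ̄ = trans (frob-cong l ζ̄) (trans (frob-+ l ζ 1#) (trans (+-cong σζ′ (frob-1 l)) (solve 2 (λ z e → z :+ (:1 :+ e) :+ :1 := z :+ e) refl ζ ε)))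
      identity : det′ (ζ + (1# + ε)) (ζ + ε) ζ (ζ + 1#) 1# 1# 1# 1# ≈ 0#
      identity = solve 3 (λ D i z →
        let D′ = D :+ i :+ i :* i
            N = λ X Xb y yb → D :* (X :* y) :+ i :* i :* (X :* yb) :+ D′ :* (Xb :* yb)
        in N (z :+ (:1 :+ i)) (z :+ i) z (z :+ :1) :* N :1 :1 :1 :1 :+ N (z :+ i) (z :+ (:1 :+ i)) (z :+ :1) z :* N :1 :1 :1 :1 := con false)
        refl D ε ζ

    -- If N z and N w are proportional but z and w are not, then (z w̄ + D (z + z̄) (w + w̄)) / det z w is an excluded ζ.
    separates : σ D ≈ D′ → (∀ ζ → bar ζ ≈ ζ + 1# → ¬ (σ ζ + ζ ≈ 1# + ε)) → SeparatesLines a d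
    separates σD excluded z w det-N≈0 = decidable-stable (det z w ≟ 0#) λ L≉0 →
      let
        L = det z w
        T = inv L L≉0
        LT≈1 : L * T ≈ 1#
        LT≈1 = proj₂ (invertible L L≉0)
        A = z * bar w + D * ((z + bar z) * (w + bar w))
        B = σ z * σ (bar w) + D′ * ((σ z + σ (bar z)) * (σ w + σ (bar w)))
        Lσ = σ z * σ (bar w) + σ (bar z) * σ w
        z̄w = bar z * w + D * ((z + bar z) * (w + bar w))
        fixed-S : ∀ x → bar x + bar (bar x) ≈ x + bar x
        fixed-S x = trans (+-congˡ (bar-involutive x)) (+-comm _ _)

        σL : σ L ≈ Lσ
        σL = trans (frob-+ l _ _) (+-cong (frob-* l _ _) (frob-* l _ _))

        -- The place where condition (2) enters: it carries `D` to `D′`.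
        σA : σ A ≈ B
        σA = trans (frob-+ l _ _) (+-cong (frob-* l _ _) (trans (frob-* l _ _) (*-cong σD (trans (frob-* l _ _) (*-cong (frob-+ l _ _) (frob-+ l _ _))))))

        Ā : bar A ≈ z̄w
        Ā = trans (frob-+ k _ _) (+-cong (trans (frob-* k _ _) (*-congˡ (bar-involutive w)))
          (trans (frob-* k _ _) (*-cong fixed-D (trans (frob-* k _ _) (*-cong (trans (frob-+ k _ _) (fixed-S z)) (trans (frob-+ k _ _) (fixed-S w)))))))

        fL : Fixed k L
        fL = trans (frob-+ k _ _) (trans (+-cong (trans (frob-* k _ _) (*-congˡ (bar-involutive w))) (trans (frob-* k _ _) (*-congʳ (bar-involutive z)))) (+-comm _ _))

        σLσT≈1 : Lσ * σ T ≈ 1#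
        σLσT≈1 = trans (*-congʳ (sym σL)) (trans (sym (frob-* l L T)) (trans (frob-cong l LT≈1) (frob-1 l)))

        bracket≈0 : B * L + A * Lσ + (1# + ε) * (L * Lσ) ≈ 0#
        bracket≈0 = *-cancelˡ-0 (*-≉0 ε≉0 ε≉0) (trans (sym (det′-formula _ _ _ _ _ _ _ _)) (det-N≈0⇒det′≈0 z w det-N≈0))
      in excluded (A * T)
        (begin
          bar (A * T)                    ≈⟨ frob-* k A T ⟩
          bar A * bar T                  ≈⟨ *-cong Ā (fixed-inverse k LT≈1 fL) ⟩
          z̄w * T                         ≈⟨ solve 7 (λ z zb w wb D S T → (zb :* w :+ D :* S) :* T := (z :* wb :+ D :* S) :* T :+ (z :* wb :+ zb :* w) :* T) refl z (bar z) w (bar w) D ((z + bar z) * (w + bar w)) T ⟩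
          A * T + L * T                  ≈⟨ +-congˡ LT≈1 ⟩
          A * T + 1#                     ∎)
        (x+y≈0⇒x≈y (begin
          σ (A * T) + A * T + (1# + ε)                                    ≈⟨ +-cong (+-cong (trans (frob-* l A T) (*-congʳ σA)) (sym (*-identityʳ _))) (sym (*-identityʳ _)) ⟩
          B * σ T + A * T * 1# + (1# + ε) * 1#                            ≈⟨ +-cong (+-cong (sym (*-identityʳ _)) (*-congˡ (sym σLσT≈1))) (*-congˡ (trans (sym (*-identityˡ 1#)) (*-cong (sym LT≈1) (sym σLσT≈1)))) ⟩
          B * σ T * 1# + A * T * (Lσ * σ T) + (1# + ε) * (L * T * (Lσ * σ T))  ≈⟨ +-congʳ (+-congʳ (*-congˡ (sym LT≈1))) ⟩
          B * σ T * (L * T) + A * T * (Lσ * σ T) + (1# + ε) * (L * T * (Lσ * σ T))  ≈⟨ solve 7 (λ A B L M e T U → B :* U :* (L :* T) :+ A :* T :* (M :* U) :+ (:1 :+ e) :* (L :* T :* (M :* U)) := (B :* L :+ A :* M :+ (:1 :+ e) :* (L :* M)) :* (T :* U)) refl A B L Lσ ε T (σ T) ⟩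
          (B * L + A * Lσ + (1# + ε) * (L * Lσ)) * (T * σ T)              ≈⟨ trans (*-congʳ bracket≈0) (zeroˡ _) ⟩
          0#                                                              ∎))

    separates⇒σD : SeparatesLines a d → σ D ≈ D′
    separates⇒σD sep = decidable-stable (σ D ≟ D′) λ σD≉D′ → cases σD≉D′ (idempotent⇒0∨1 (A ≟ 0#) A²≈A)
      where
      ζ = proj₁ (artin-schreier fixed-D)
      ζ²+ζ = proj₂ (artin-schreier fixed-D)
      A = ζ + bar ζ

      A²≈A : A * A ≈ A
      A²≈A = conjugate-root fixed-D ζ²+ζ

      -- `σ ζ` is a root of `X² + X = σ D`, so the displacement `s` of `ζ` under `σ` determines
      -- `σ D`. The `s` that give `D′` are `ε` and `1 + ε`.
      σζ≈⇒σD : ∀ {s} → σ ζ ≈ ζ + s → s * s + s ≈ ε + ε * ε → σ D ≈ D′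
      σζ≈⇒σD {s} σζ s²+s = begin
        σ D                                ≈⟨ frob-root l ζ²+ζ ⟨
        σ ζ * σ ζ + σ ζ                    ≈⟨ +-cong (*-cong σζ σζ) σζ ⟩
        (ζ + s) * (ζ + s) + (ζ + s)        ≈⟨ solve 2 (λ z s → (z :+ s) :* (z :+ s) :+ (z :+ s) := (z :* z :+ z) :+ (s :* s :+ s)) refl ζ s ⟩
        (ζ * ζ + ζ) + (s * s + s)          ≈⟨ +-cong ζ²+ζ s²+s ⟩
        D + (ε + ε * ε)                    ≈⟨ +-assoc _ _ _ ⟨
        D′                                 ∎

      module _ (σD≉D′ : ¬ (σ D ≈ D′)) where

        σ-injective : Injective _≈_ _≈_ σ
        σ-injective {x} {y} σx≈σy = decidable-stable (x ≟ y) λ x≉y →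
          frob-≉0 l (λ x+y≈0 → x≉y (x+y≈0⇒x≈y x+y≈0)) (trans (frob-+ l x y) (x≈y⇒x+y≈0 σx≈σy))

        -- Here N ζ and N w are proportional for σ w = ζ + ε.
        unfixed-case : ¬ (A ≈ 1#)
        unfixed-case A≈1 = σD≉D′ (σζ≈⇒σD (trans (frob-cong l ζ≈w) σw) (+-comm _ _))
          where
          w = proj₁ (injective⇒preimage (frob-cong l) σ-injective (ζ + ε))
          σw : σ w ≈ ζ + ε
          σw = proj₂ (injective⇒preimage (frob-cong l) σ-injective (ζ + ε))
          ζ̄ : bar ζ ≈ ζ + 1#
          ζ̄ = trans (solve 2 (λ x y → y := x :+ (x :+ y)) refl ζ (bar ζ)) (+-congˡ A≈1)
          σw̄ : σ (bar w) ≈ ζ + ε + 1#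
          σw̄ = begin
            σ (bar w)         ≈⟨ frob-comm l k w ⟩
            bar (σ w)         ≈⟨ frob-cong k σw ⟩
            bar (ζ + ε)       ≈⟨ frob-+ k ζ ε ⟩
            bar ζ + bar ε     ≈⟨ +-cong ζ̄ fε ⟩
            ζ + 1# + ε        ≈⟨ solve 2 (λ z e → z :+ :1 :+ e := z :+ e :+ :1) refl ζ ε ⟩
            ζ + ε + 1#        ∎
          w̄ : bar w ≈ w + 1#
          w̄ = σ-injective (trans σw̄ (sym (trans (frob-+ l w 1#) (+-cong σw (frob-1 l)))))
          identity : det′ (σ ζ) (σ ζ + 1#) ζ (ζ + 1#) (ζ + ε) (ζ + ε + 1#) w (w + 1#) ≈ 0#
          identity = trans (+-cong (*-cong (f≈ _ _ _ _) (f≈ _ _ _ _)) (*-cong (f≈ _ _ _ _) (f≈ _ _ _ _))) (solve 4 (λ i z Z w →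
            let D = z :* z :+ z
                D′ = D :+ i :+ i :* i
                N = λ X Xb y yb → D :* (X :* y) :+ i :* i :* (X :* yb) :+ D′ :* (Xb :* yb)
            in N Z (Z :+ :1) z (z :+ :1) :* N (z :+ i :+ :1) (z :+ i) (w :+ :1) w :+ N (Z :+ :1) Z (z :+ :1) z :* N (z :+ i) (z :+ i :+ :1) w (w :+ :1) := con false)
            refl ε ζ (σ ζ) w)
            where
            f≈ : ∀ X X̄ y ȳ → form′ X X̄ y ȳ ≈ (ζ * ζ + ζ) * (X * y) + ε * ε * (X * ȳ) + (ζ * ζ + ζ + ε + ε * ε) * (X̄ * ȳ)
            f≈ X X̄ y ȳ = sym (+-cong (+-congʳ (*-congʳ ζ²+ζ)) (*-congʳ (+-congʳ (+-congʳ ζ²+ζ))))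
          -- Both have relative trace 1, so `det ζ w = ζ + w`, and separation identifies them. Then
          -- `σ ζ = ζ + ε`, which would give condition (2).
          ζ≈w : ζ ≈ w
          ζ≈w = x+y≈0⇒x≈y (begin
            ζ + w                            ≈⟨ solve 2 (λ z w → z :+ w := z :* (w :+ :1) :+ (z :+ :1) :* w) refl ζ w ⟩
            ζ * (w + 1#) + (ζ + 1#) * w      ≈⟨ +-cong (*-congˡ w̄) (*-congʳ ζ̄) ⟨
            det ζ w                          ≈⟨ sep ζ w (det′≈0⇒det-N≈0 ζ w (trans (det′-cong refl (trans (frob-cong l ζ̄) (trans (frob-+ l ζ 1#) (+-congˡ (frob-1 l)))) refl ζ̄ σw σw̄ refl w̄) identity)) ⟩
            0#                               ∎)

        -- In the coordinate with zeros and poles at the roots of Z² + Z = D, the form N becomes the binomial M.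
        fixed-case : ¬ (A ≈ 0#)
        fixed-case A≈0 = ¬M-separates C fC C≉0 1+C≉0 (unique-root {Q = Q} (ℕ.m^n>0 2 k) (q+1∣1+Qj k l)) M-separates
          where
          ζ̄ : bar ζ ≈ ζ
          ζ̄ = sym (x+y≈0⇒x≈y A≈0)
          -- `C = 0` and `C = 1` correspond to the two displacements `1 + ε` and `ε` of `ζ` that
          -- give condition (2).
          C = 1# + ε + σ ζ + ζ
          fC : Fixed k C
          fC = fixed-+ k (fixed-+ k (fixed-+ k (frob-1 k) fε) (fixed-frob k l ζ̄)) ζ̄
          C≉0 : ¬ (C ≈ 0#)
          C≉0 C≈0 = σD≉D′ (σζ≈⇒σD {1# + ε} (x+y≈0⇒x≈y (trans (solve 3 (λ e s z → s :+ (z :+ (:1 :+ e)) := :1 :+ e :+ s :+ z) refl ε (σ ζ) ζ) C≈0))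
            (solve 1 (λ e → (:1 :+ e) :* (:1 :+ e) :+ (:1 :+ e) := e :+ e :* e) refl ε))
          1+C≉0 : ¬ (1# + C ≈ 0#)
          1+C≉0 1+C≈0 = σD≉D′ (σζ≈⇒σD {ε} (x+y≈0⇒x≈y (trans (solve 3 (λ e s z → s :+ (z :+ e) := :1 :+ (:1 :+ e :+ s :+ z)) refl ε (σ ζ) ζ) 1+C≈0)) (+-comm _ _))

          -- As `(1 + ζ) z + ζ z̄` with `ζ` in F_q, this is F_q-linear of determinant
          -- `(1 + ζ)² + ζ² = 1`, so it preserves `det`.
          κ : Carrier → Carrier
          κ z = z + ζ * (z + bar z)

          κ̄ : ∀ z → bar (κ z) ≈ bar z + ζ * (z + bar z)
          κ̄ z = trans (frob-+ k z _) (+-congˡ (trans (frob-* k ζ _) (*-cong ζ̄ (trans (frob-+ k z (bar z)) (trans (+-congˡ (bar-involutive z)) (+-comm _ _))))))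

          det-κ : ∀ z w → det (κ z) (κ w) ≈ det z w
          det-κ z w = trans (+-cong (*-congˡ (κ̄ w)) (*-congʳ (κ̄ z)))
            (solve 5 (λ r z zb w wb → (z :+ r :* (z :+ zb)) :* (wb :+ r :* (w :+ wb)) :+ (zb :+ r :* (z :+ zb)) :* (w :+ r :* (w :+ wb)) := z :* wb :+ zb :* w) refl ζ z (bar z) w (bar w))

          s = ε * ζ + D + ε

          fs : Fixed k s
          fs = fixed-+ k (fixed-+ k (fixed-* k fε ζ̄) fixed-D) fε

          -- The right side is `(ε + s) M + s M̄`: an F_q-linear map of determinant
          -- `(ε + s)² + s² = ε²`, hence invertible, applied to `M`. So separation passes from `N`
          -- to `M`.
          N-κ : ∀ z → ε * ε * N a d (κ z) ≈ ε * M C fC z + s * (M C fC z + bar (M C fC z))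
          N-κ z = begin
            ε * ε * N a d (κ z)                                                      ≈⟨ ε²*form _ _ _ _ ⟩
            form′ (σ (κ z)) (σ (bar (κ z))) (κ z) (bar (κ z))                        ≈⟨ +-cong (+-cong (*-cong (sym ζ²+ζ) (*-congʳ σκ)) (*-congˡ (*-cong σκ (κ̄ z)))) (*-cong (+-congʳ (+-congʳ (sym ζ²+ζ))) (*-cong σκ̄ (κ̄ z))) ⟩
            (ζ * ζ + ζ) * ((σ z + r * (σ z + Z̄)) * κ z) + ε * ε * ((σ z + r * (σ z + Z̄)) * (bar z + ζ * (z + bar z)))
              + (ζ * ζ + ζ + ε + ε * ε) * ((Z̄ + r * (σ z + Z̄)) * (bar z + ζ * (z + bar z)))
              ≈⟨ solve 7 (λ i p r z zb Z Zb →
                   let D = p :* p :+ p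
                       C = :1 :+ i :+ r :+ p
                       m = z :* (C :* Z :+ (:1 :+ C) :* Zb)
                       mb = zb :* (C :* Zb :+ (:1 :+ C) :* Z)
                   in D :* ((Z :+ r :* (Z :+ Zb)) :* (z :+ p :* (z :+ zb))) :+ i :* i :* ((Z :+ r :* (Z :+ Zb)) :* (zb :+ p :* (z :+ zb)))
                      :+ (D :+ i :+ i :* i) :* ((Zb :+ r :* (Z :+ Zb)) :* (zb :+ p :* (z :+ zb)))
                      := i :* m :+ (i :* p :+ D :+ i) :* (m :+ mb)) refl ε ζ r z (bar z) (σ z) Z̄ ⟩
            ε * M C fC z + (ε * ζ + (ζ * ζ + ζ) + ε) * (M C fC z + bar z * (C * Z̄ + (1# + C) * σ z))  ≈⟨ +-congˡ (*-cong (+-congʳ (+-congˡ ζ²+ζ)) (+-congˡ (sym M̄))) ⟩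
            ε * M C fC z + s * (M C fC z + bar (M C fC z))                           ∎
            where
            r = σ ζ
            Z̄ = σ (bar z)
            σS : σ (z + bar z) ≈ σ z + Z̄
            σS = frob-+ l z (bar z)
            σκ : σ (κ z) ≈ σ z + r * (σ z + Z̄)
            σκ = trans (frob-+ l z _) (+-congˡ (trans (frob-* l ζ _) (*-congˡ σS)))
            σκ̄ : σ (bar (κ z)) ≈ Z̄ + r * (σ z + Z̄)
            σκ̄ = trans (frob-cong l (κ̄ z)) (trans (frob-+ l (bar z) _) (+-congˡ (trans (frob-* l ζ _) (*-congˡ σS))))
            M̄ : bar (M C fC z) ≈ bar z * (C * Z̄ + (1# + C) * σ z)
            M̄ = trans (frob-* k z _) (*-congˡ (trans (frob-+ k _ _) (+-cong
              (trans (frob-* k C _) (*-cong fC (frob-comm k l z)))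
              (trans (frob-* k _ _) (*-cong (fixed-+ k (frob-1 k) fC) (trans (frob-comm k l (bar z)) (frob-cong l (bar-involutive z))))))))

          det-Mκ : ∀ z w → ε * ε * (ε * ε) * det (N a d (κ z)) (N a d (κ w)) ≈ ε * ε * det (M C fC z) (M C fC w)
          det-Mκ z w = begin
            ε * ε * (ε * ε) * det (N a d (κ z)) (N a d (κ w))      ≈⟨ det-scale (fixed-* k fε fε) (fixed-* k fε fε) _ _ ⟨
            det (ε * ε * N a d (κ z)) (ε * ε * N a d (κ w))        ≈⟨ det-cong (N-κ z) (N-κ w) ⟩
            det (ε * m + s * (m + bar m)) (ε * n + s * (n + bar n))  ≈⟨ +-cong (*-congˡ (conj n)) (*-congʳ (conj m)) ⟩
            (ε * m + s * (m + bar m)) * (ε * bar n + s * (n + bar n)) + (ε * bar m + s * (m + bar m)) * (ε * n + s * (n + bar n))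
              ≈⟨ solve 6 (λ e s m mb n nb → (e :* m :+ s :* (m :+ mb)) :* (e :* nb :+ s :* (n :+ nb)) :+ (e :* mb :+ s :* (m :+ mb)) :* (e :* n :+ s :* (n :+ nb)) := e :* e :* (m :* nb :+ mb :* n)) refl ε s m (bar m) n (bar n) ⟩
            ε * ε * det m n                                        ∎
            where
            m = M C fC z
            n = M C fC w
            conj : ∀ x → bar (ε * x + s * (x + bar x)) ≈ ε * bar x + s * (x + bar x)
            conj x = trans (frob-+ k _ _) (+-cong (trans (frob-* k ε x) (*-congʳ fε)) (trans (frob-* k s _)
              (*-cong fs (trans (frob-+ k x (bar x)) (trans (+-congˡ (bar-involutive x)) (+-comm _ _))))))

          M-separates : M-lines.SeparatesLines C fC
          M-separates z w det≈0 = trans (sym (det-κ z w)) (sep (κ z) (κ w)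
            (*-cancelˡ-0 (*-≉0 (*-≉0 ε≉0 ε≉0) (*-≉0 ε≉0 ε≉0)) (trans (det-Mκ z w) (trans (*-congˡ det≈0) (zeroʳ _)))))

        cases : A ≈ 0# ⊎ A ≈ 1# → ⊥
        cases (inj₁ A≈0) = fixed-case A≈0
        cases (inj₂ A≈1) = unfixed-case A≈1

-- Coprimality of Q - 1 and q + 1 forces l/m to be odd

parity : ∀ n → (∃ λ j → n ≡ j ℕ.* 2) ⊎ (∃ λ j → n ≡ suc (j ℕ.* 2))
parity zero    = inj₁ (0 , ≡.refl)
parity (suc n) = [ (λ (j , eq) → inj₂ (j , ≡.cong suc eq)) , (λ (j , eq) → inj₁ (suc j , ≡.cong suc eq)) ]′ (parity n)

module _ (k l : ℕ) .{{_ : NonZero k}} .{{_ : NonZero l}} (coprime : gcd (2 ℕ.^ l ∸ 1) (1 ℕ.+ 2 ℕ.^ k) ≡ 1) where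
  open ℕ-Arithmetic using (r^even≡1; 1+r∣1+r^odd)

  private
    o m r : ℕ
    o = ord₂ (gcd k l)
    m = 2 ℕ.^ o
    r = 2 ℕ.^ m

    instance
      nonZero-m : NonZero m
      nonZero-m = m^n≢0 2 o
      nonZero-r : NonZero r
      nonZero-r = m^n≢0 2 m

    m∣gcd : m ∣ gcd k l
    m∣gcd = ord₂-∣ (gcd k l)

    2^n : ∀ {n} t → n ≡ t ℕ.* m → r ℕ.^ t ≡ 2 ℕ.^ n
    2^n t eq = ≡.trans (ℕ.^-*-assoc 2 m t) (≡.cong (2 ℕ.^_) (≡.trans (ℕ.*-comm m t) (≡.sym eq)))

    2m∣ : ∀ {n} j → n ≡ j ℕ.* 2 ℕ.* m → 2 ℕ.^ suc o ∣ n
    2m∣ j eq = ∣.divides j (≡.trans eq (ℕ.*-assoc j 2 m))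

    gcd-nonZero : NonZero (gcd k l)
    gcd-nonZero = ℕ.≢-nonZero (gcd[m,n]≢0 k l (inj₁ (ℕ.≢-nonZero⁻¹ k)))

    ¬2m∣both : 2 ℕ.^ suc o ∣ k → 2 ℕ.^ suc o ∣ l → ⊥
    ¬2m∣both 2m∣k 2m∣l = ℕ.1+n≰n (ord₂-max (gcd k l) {{gcd-nonZero}} (suc o) (gcd-greatest 2m∣k 2m∣l))

    -- An odd power of `r = 2 ^ m` plus 1 and an even power minus 1 are both multiples of `r + 1`,
    -- which would then divide `gcd (Q ∸ 1) (1 + q)`.
    ¬odd-even : ∀ i j → k ≡ suc (i ℕ.* 2) ℕ.* m → l ≡ j ℕ.* 2 ℕ.* m → ⊥
    ¬odd-even i j k≡ l≡ = ℕ.≢-nonZero⁻¹ r (ℕ.suc-injective (∣.∣1⇒≡1 (≡.subst (suc r ∣_) coprime (gcd-greatest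
      (∣.divides t (≡.trans (≡.cong (_∸ 1) (≡.trans (≡.sym (2^n (j ℕ.* 2) l≡)) eq)) ≡.refl))
      (≡.subst (λ x → suc r ∣ 1 ℕ.+ x) (2^n (suc (i ℕ.* 2)) k≡) (1+r∣1+r^odd r i))))))
      where
      t = proj₁ (r^even≡1 r j)
      eq = proj₂ (r^even≡1 r j)

  k≡k/m*m : k ≡ (k / m) ℕ.* m
  k≡k/m*m = ≡.sym (m/n*n≡m (∣.∣-trans m∣gcd (gcd[m,n]∣m k l)))

  -- If `l / m` were even, then `k / m` could not be even, as `2 m` would divide `gcd k l` against
  -- the maximality of `m`, nor odd, by coprimality.
  l/m-odd : ∃ λ j → l ≡ suc (j ℕ.* 2) ℕ.* m
  l/m-odd = at (∣.∣-trans m∣gcd (gcd[m,n]∣n k l))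
    where
    at : m ∣ l → ∃ λ j → l ≡ suc (j ℕ.* 2) ℕ.* m
    at (∣.divides t l≡) = [ (λ (j , t≡) → ⊥-elim (even j (≡.trans l≡ (≡.cong (ℕ._* m) t≡)))) , (λ (j , t≡) → j , ≡.trans l≡ (≡.cong (ℕ._* m) t≡)) ]′ (parity t)
      where
      even : ∀ j → l ≡ j ℕ.* 2 ℕ.* m → ⊥
      even j l≡ = [ (λ (i , eq) → ¬2m∣both (2m∣ i (≡.trans k≡k/m*m (≡.cong (ℕ._* m) eq))) (2m∣ j l≡))
                  , (λ (i , eq) → ¬odd-even i j (≡.trans k≡k/m*m (≡.cong (ℕ._* m) eq)) l≡) ]′ (parity (k / m))

-- Evaluation of polynomials

module Evaluation (F : Field c ℓ) where
  open Field F hiding (zero)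
  open Exp commutativeSemiring hiding (_^_)
  open Polynomials F
  open ≈-Reasoning setoid

  eval-+ : ∀ p r z → eval (p +ₚ r) z ≈ eval p z + eval r z
  eval-+ []      r       z = sym (+-identityˡ _)
  eval-+ (x ∷ p) []      z = sym (+-identityʳ _)
  eval-+ (x ∷ p) (y ∷ r) z = begin
    x + y + z * eval (p +ₚ r) z             ≈⟨ +-congˡ (trans (*-congˡ (eval-+ p r z)) (distribˡ z _ _)) ⟩
    x + y + (z * eval p z + z * eval r z)   ≈⟨ interchange x y _ _ ⟩
    x + z * eval p z + (y + z * eval r z)   ∎
    where open CommutativeSemigroupProperties +-commutativeSemigroup using (interchange)

  eval-scale : ∀ x p z → eval (map (x *_) p) z ≈ x * eval p z
  eval-scale x []      z = sym (zeroʳ x)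
  eval-scale x (y ∷ p) z = begin
    x * y + z * eval (map (x *_) p) z   ≈⟨ +-congˡ (trans (*-congˡ (eval-scale x p z)) (x∙yz≈y∙xz z x _)) ⟩
    x * y + x * (z * eval p z)          ≈⟨ distribˡ x _ _ ⟨
    x * (y + z * eval p z)              ∎
    where open CommutativeSemigroupProperties *-commutativeSemigroup using (x∙yz≈y∙xz)

  eval-* : ∀ p r z → eval (p *ₚ r) z ≈ eval p z * eval r z
  eval-* []      r z = sym (zeroˡ _)
  eval-* (x ∷ p) r z = begin
    eval (map (x *_) r +ₚ (0# ∷ (p *ₚ r))) z          ≈⟨ eval-+ (map (x *_) r) _ z ⟩
    eval (map (x *_) r) z + (0# + z * eval (p *ₚ r) z)  ≈⟨ +-cong (eval-scale x r z) (trans (+-identityˡ _) (*-congˡ (eval-* p r z))) ⟩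
    x * eval r z + z * (eval p z * eval r z)          ≈⟨ +-congˡ (*-assoc z _ _) ⟨
    x * eval r z + z * eval p z * eval r z            ≈⟨ distribʳ _ _ _ ⟨
    (x + z * eval p z) * eval r z                     ∎

  eval-con : ∀ x z → eval (con x) z ≈ x
  eval-con x z = trans (+-congˡ (zeroʳ z)) (+-identityʳ x)

  eval-X : ∀ z → eval X z ≈ z
  eval-X z = trans (+-identityˡ _) (trans (*-congˡ (eval-con 1# z)) (*-identityʳ z))

  eval-^ : ∀ p n z → eval (p ^ₚ n) z ≈ eval p z ^ n
  eval-^ p zero    z = eval-con 1# z
  eval-^ p (suc n) z = trans (eval-* p (p ^ₚ n) z) (*-congˡ (eval-^ p n z))

  eval-⟨⟩ : ∀ p r z → eval (p ⟨ r ⟩) z ≈ eval p (eval r z)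
  eval-⟨⟩ []      r z = refl
  eval-⟨⟩ (x ∷ p) r z = begin
    eval (con x +ₚ r *ₚ (p ⟨ r ⟩)) z                  ≈⟨ eval-+ (con x) (r *ₚ (p ⟨ r ⟩)) z ⟩
    eval (con x) z + eval (r *ₚ (p ⟨ r ⟩)) z          ≈⟨ +-cong (eval-con x z) (trans (eval-* r (p ⟨ r ⟩) z) (*-congˡ (eval-⟨⟩ p r z))) ⟩
    x + eval r z * eval p (eval r z)                  ∎

  eval-X^ : ∀ n z → eval (X ^ₚ n) z ≈ z ^ n
  eval-X^ n z = trans (eval-^ X n z) (^-congˡ n (eval-X z))

  eval-monomial : ∀ x n z → eval (con x *ₚ X ^ₚ n) z ≈ x * z ^ n
  eval-monomial x n z = trans (eval-* (con x) (X ^ₚ n) z) (*-cong (eval-con x z) (eval-X^ n z))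

-- Transport along the embedding of F_q

module Embedding {Fq : Field c ℓ} {F : Field c₁ ℓ₁} {ι : Field.Carrier Fq → Field.Carrier F} (embedding : IsFieldEmbedding Fq F ι) where
  private
    module Fq = Field Fq
  open Field F hiding (zero)
  open RingMorphisms.IsRingMonomorphism embedding public

  ι-^ : ∀ x n → ι (x Fq.^ n) ≈ ι x ^ n
  ι-^ x zero    = 1#-homo
  ι-^ x (suc n) = trans (*-homo x _) (*-congˡ (ι-^ x n))

  ι-sum : ∀ {n} (t : Vector Fq.Carrier n) → ι (Fq.sum t) ≈ sum (ι ∘ t)
  ι-sum {zero}  t = 0#-homo
  ι-sum {suc n} t = trans (+-homo _ _) (+-congˡ (ι-sum (t ∘ suc)))

  ι≈0⇒≈0 : ∀ {x} → ι x ≈ 0# → x Fq.≈ Fq.0#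
  ι≈0⇒≈0 ιx≈0 = injective (trans ιx≈0 (sym 0#-homo))

  ≈0⇒ι≈0 : ∀ {x} → x Fq.≈ Fq.0# → ι x ≈ 0#
  ≈0⇒ι≈0 x≈0 = trans (⟦⟧-cong x≈0) 0#-homo

-- The conditions over F_q and the equivalence

module Main (k l : ℕ) .{{_ : NonZero k}} .{{_ : NonZero l}}
            (coprime : gcd (2 ℕ.^ l ∸ 1) (1 ℕ.+ 2 ℕ.^ k) ≡ 1)
            (Fq : Field c ℓ) (order-q : HasOrder Fq (2 ℕ.^ k))
            (F : Field c₁ ℓ₁) (order-q² : HasOrder F ((2 ℕ.^ k) ℕ.^ 2))
            (ι : Field.Carrier Fq → Field.Carrier F) (embedding : IsFieldEmbedding Fq F ι)
            (a d : Field.Carrier Fq) (u v : ℕ)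
            (u≡ : (u ℕ.* (2 ℕ.^ l ∸ 1)) % (1 ℕ.+ 2 ℕ.^ k) ≡ 2 ℕ.^ l % (1 ℕ.+ 2 ℕ.^ k))
            (v≡ : (v ℕ.* (2 ℕ.^ l ∸ 1)) % (1 ℕ.+ 2 ℕ.^ k) ≡ 2 ℕ.^ k % (1 ℕ.+ 2 ℕ.^ k)) where
  private
    module Fq = Field Fq
  open Field F hiding (zero)
  open Embedding {Fq = Fq} {F} embedding using (ι-^; ι-sum; ι≈0⇒≈0; ≈0⇒ι≈0; +-homo; *-homo; 1#-homo; ⟦⟧-cong; injective)
  open Criterion F k l (≡.subst (HasOrder F) (ℕ.^-*-assoc 2 k 2) order-q²) hiding (con)
  open Evaluation F
  open Polynomials F
  open ≈-Reasoning setoid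

  fixed-ι : ∀ x → Fixed k (ι x)
  fixed-ι x = trans (sym (ι-^ x q)) (⟦⟧-cong (FiniteField.x^order≈x Fq order-q {{m^n≢0 2 k}} x))

  a′ d′ E : Carrier
  a′ = ι a
  d′ = ι d
  E = 1# + a′ + d′

  e : Fq.Carrier
  e = Fq.1# Fq.+ a Fq.^ 2 Fq.+ d Fq.^ 2

  f : Poly
  f = X *ₚ ((con 1# +ₚ con a′ *ₚ X ^ₚ u +ₚ con d′ *ₚ X ^ₚ v) ⟨ X ^ₚ (q ∸ 1) ⟩)

  g : Carrier → Carrier
  g = trinomial a′ d′ u v u≡ v≡

  eval-f : ∀ x → eval f x ≈ g x
  eval-f x = begin
    eval f x                          ≈⟨ trans (eval-* X (A ⟨ X ^ₚ (q ∸ 1) ⟩) x) (*-cong (eval-X x) (eval-⟨⟩ A (X ^ₚ (q ∸ 1)) x)) ⟩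
    x * eval A y                      ≈⟨ *-congˡ (trans (eval-+ (con 1# +ₚ con a′ *ₚ X ^ₚ u) (con d′ *ₚ X ^ₚ v) y)
                                         (+-cong (trans (eval-+ (con 1#) (con a′ *ₚ X ^ₚ u) y) (+-cong (eval-con 1# y) (term a′ u))) (term d′ v))) ⟩
    g x                               ∎
    where
    A = con 1# +ₚ con a′ *ₚ X ^ₚ u +ₚ con d′ *ₚ X ^ₚ v
    y = eval (X ^ₚ (q ∸ 1)) x
    term : ∀ b n → eval (con b *ₚ X ^ₚ n) y ≈ b * (x ^ (q ∸ 1)) ^ n
    term b n = trans (eval-monomial b n y) (*-congˡ (^-congˡ n (eval-X^ (q ∸ 1) x)))

  permutes⇒separates : Permutes f → SeparatesLines a′ d′
  permutes⇒separates (f-injective , _) = trinomial-injective⇒separates a′ d′ u v u≡ v≡ coprime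
    (λ eq → f-injective (trans (eval-f _) (trans eq (sym (eval-f _)))))

  separates⇒permutes : SeparatesLines a′ d′ → Permutes f
  separates⇒permutes sep = f-injective , f-surjective
    where
    g-injective : Injective _≈_ _≈_ g
    g-injective = separates⇒trinomial-injective a′ d′ u v u≡ v≡ coprime sep
    f-injective : Injective _≈_ _≈_ (eval f)
    f-injective eq = g-injective (trans (sym (eval-f _)) (trans eq (eval-f _)))
    f-surjective : ∀ y → ∃ λ x → ∀ {z} → z ≈ x → eval f z ≈ y
    f-surjective y = let (x , gx≈y) = injective⇒preimage (trinomial-cong a′ d′ u v u≡ v≡) g-injective y
                     in x , λ {z} z≈x → trans (eval-f z) (trans (trinomial-cong a′ d′ u v u≡ v≡ z≈x) gx≈y)

  ιe≈E² : ι e ≈ E * E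
  ιe≈E² = begin
    ι e                           ≈⟨ trans (+-homo _ _) (+-cong (trans (+-homo _ _) (+-cong 1#-homo (ι-^ a 2))) (ι-^ d 2)) ⟩
    1# + a′ ^ 2 + d′ ^ 2          ≈⟨ solve 2 (λ a d → :1 :+ a :^ 2 :+ d :^ 2 := (:1 :+ a :+ d) :* (:1 :+ a :+ d)) refl a′ d′ ⟩
    E * E                         ∎

  e≉0⇒E≉0 : ¬ (e Fq.≈ Fq.0#) → ¬ (E ≈ 0#)
  e≉0⇒E≉0 e≉0 E≈0 = e≉0 (ι≈0⇒≈0 (trans ιe≈E² (trans (*-congʳ E≈0) (zeroˡ E))))

  E≉0⇒e≉0 : ¬ (E ≈ 0#) → ¬ (e Fq.≈ Fq.0#)
  E≉0⇒e≉0 E≉0 e≈0 = *-≉0 E≉0 E≉0 (trans (sym ιe≈E²) (≈0⇒ι≈0 e≈0))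

  -- `N 1 = 1 + a + d`, and a form that separates lines vanishes only at 0.
  separates⇒E≉0 : SeparatesLines a′ d′ → ¬ (E ≈ 0#)
  separates⇒E≉0 sep E≈0 = G-≉0 a′ d′ sep 1≉0 (begin
    N a′ d′ 1#                        ≈⟨ form-cong a′ d′ (frob-1 l) (trans (frob-cong l (frob-1 k)) (frob-1 l)) refl (frob-1 k) ⟩
    form a′ d′ 1# 1# 1# 1#            ≈⟨ solve 2 (λ a d → d :* (:1 :* :1) :+ :1 :* :1 :+ a :* (:1 :* :1) := :1 :+ a :+ d) refl a′ d′ ⟩
    E                                 ≈⟨ E≈0 ⟩
    0#                                ∎)

  sum≈tr : ∀ i n x → sum {n} (λ j → x ^ ((2 ℕ.^ i) ℕ.^ toℕ j)) ≈ tr i n x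
  sum≈tr i zero    x = refl
  sum≈tr i (suc n) x = +-cong (*-identityʳ x) (begin
    sum {n} (λ j → x ^ (2 ℕ.^ i ℕ.* (2 ℕ.^ i) ℕ.^ toℕ j))   ≈⟨ sum-cong-≋ {n} (λ j → ^-assocʳ x (2 ℕ.^ i) ((2 ℕ.^ i) ℕ.^ toℕ j)) ⟨
    sum {n} (λ j → frob i x ^ ((2 ℕ.^ i) ℕ.^ toℕ j))        ≈⟨ sum≈tr i n (frob i x) ⟩
    tr i n (frob i x)                                       ≈⟨ tr-frob i n i x ⟩
    frob i (tr i n x)                                       ∎)
    where open SemiringSum semiring using (sum-cong-≋)

  module _ (E≉0 : ¬ (E ≈ 0#)) where
    ε : Carrier
    ε = inv E E≉0

    Eε≈1 : E * ε ≈ 1#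
    Eε≈1 = proj₂ (invertible E E≉0)

    E²ε²≈1 : E * E * (ε * ε) ≈ 1#
    E²ε²≈1 = trans (solve 2 (λ E ε → E :* E :* (ε :* ε) := (E :* ε) :* (E :* ε)) refl E ε) (trans (*-cong Eε≈1 Eε≈1) (*-identityˡ 1#))

    -- With `e = E²` this is `e^(Q-1) e^(-Q) = e^(-1)`: scaling condition (2) by `e^(-Q)` turns it
    -- into `σ D = a / e`.
    [E²]^[Q∸1]*σε² : (E * E) ^ (Q ∸ 1) * σ (ε * ε) ≈ ε * ε
    [E²]^[Q∸1]*σε² = begin
      (E * E) ^ (Q ∸ 1) * σ (ε * ε)                    ≈⟨ *-congˡ (x*x^[Q∸1] (ε * ε)) ⟨
      (E * E) ^ (Q ∸ 1) * (ε * ε * (ε * ε) ^ (Q ∸ 1))  ≈⟨ solve 3 (λ p e r → p :* (e :* r) := e :* (p :* r)) refl _ (ε * ε) _ ⟩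
      ε * ε * ((E * E) ^ (Q ∸ 1) * (ε * ε) ^ (Q ∸ 1))  ≈⟨ *-congˡ (^-distrib-* (E * E) (ε * ε) (Q ∸ 1)) ⟨
      ε * ε * (E * E * (ε * ε)) ^ (Q ∸ 1)              ≈⟨ *-congˡ (trans (^-congˡ (Q ∸ 1) E²ε²≈1) (1^n≈1 (Q ∸ 1))) ⟩
      ε * ε * 1#                                       ≈⟨ *-identityʳ _ ⟩
      ε * ε                                            ∎

    D₀ D₀′ : Carrier
    D₀ = D (fixed-ι a) (fixed-ι d) Eε≈1
    D₀′ = D′ (fixed-ι a) (fixed-ι d) Eε≈1

    rhs*σε² : (E * E) ^ (Q ∸ 1) * a′ * σ (ε * ε) ≈ D₀′
    rhs*σε² = begin
      (E * E) ^ (Q ∸ 1) * a′ * σ (ε * ε)     ≈⟨ solve 3 (λ p a s → p :* a :* s := a :* (p :* s)) refl _ a′ _ ⟩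
      a′ * ((E * E) ^ (Q ∸ 1) * σ (ε * ε))   ≈⟨ *-congˡ [E²]^[Q∸1]*σε² ⟩
      a′ * (ε * ε)                           ≈⟨ aε²≈D′ (fixed-ι a) (fixed-ι d) Eε≈1 ⟩
      D₀′                                    ∎

    ι-rhs : ι (e Fq.^ (Q ∸ 1) Fq.* a) ≈ (E * E) ^ (Q ∸ 1) * a′
    ι-rhs = trans (*-homo _ a) (*-congʳ (trans (ι-^ e (Q ∸ 1)) (^-congˡ (Q ∸ 1) ιe≈E²)))

    d^Q⇒σD : d Fq.^ Q Fq.≈ e Fq.^ (Q ∸ 1) Fq.* a → σ D₀ ≈ D₀′
    d^Q⇒σD d^Q = begin
      σ (d′ * (ε * ε))                       ≈⟨ frob-* l d′ _ ⟩
      σ d′ * σ (ε * ε)                       ≈⟨ *-congʳ (trans (sym (ι-^ d Q)) (trans (⟦⟧-cong d^Q) ι-rhs)) ⟩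
      (E * E) ^ (Q ∸ 1) * a′ * σ (ε * ε)     ≈⟨ rhs*σε² ⟩
      D₀′                                    ∎

    σD⇒d^Q : σ D₀ ≈ D₀′ → d Fq.^ Q Fq.≈ e Fq.^ (Q ∸ 1) Fq.* a
    σD⇒d^Q σD = injective (trans (ι-^ d Q) (trans (*-cancelˡ-≉0 (frob-≉0 l (*-≉0 ε≉0 ε≉0)) (begin
      σ (ε * ε) * σ d′                         ≈⟨ *-comm _ _ ⟩
      σ d′ * σ (ε * ε)                         ≈⟨ frob-* l d′ _ ⟨
      σ D₀                                     ≈⟨ trans σD (sym rhs*σε²) ⟩
      (E * E) ^ (Q ∸ 1) * a′ * σ (ε * ε)       ≈⟨ *-comm _ _ ⟩
      σ (ε * ε) * ((E * E) ^ (Q ∸ 1) * a′)     ∎)) (sym ι-rhs)))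
      where
      ε≉0 : ¬ (ε ≈ 0#)
      ε≉0 = inverse-≉0 Eε≈1

    -- `(a² + d²) / e` is the square of `1 + ε = (a + d) / E`, and the trace commutes with squaring;
    -- condition (3) thus speaks about the trace of `1 + ε`.
    ι-Trace : ∀ i n (e≉0 : ¬ (e Fq.≈ Fq.0#)) →
              ι (Trace Fq (2 ℕ.^ i) n ((a Fq.^ 2 Fq.+ d Fq.^ 2) Fq.* Fq.inv e e≉0)) ≈ tr i n (1# + ε) * tr i n (1# + ε)
    ι-Trace i n e≉0 = begin
      ι (Trace Fq (2 ℕ.^ i) n x)                        ≈⟨ ι-sum {n} (λ j → x Fq.^ ((2 ℕ.^ i) ℕ.^ toℕ j)) ⟩
      sum {n} (λ j → ι (x Fq.^ ((2 ℕ.^ i) ℕ.^ toℕ j)))  ≈⟨ sum-cong-≋ {n} (λ j → trans (ι-^ x ((2 ℕ.^ i) ℕ.^ toℕ j)) (^-congˡ ((2 ℕ.^ i) ℕ.^ toℕ j) ιx)) ⟩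
      sum {n} (λ j → frob 1 (1# + ε) ^ ((2 ℕ.^ i) ℕ.^ toℕ j))  ≈⟨ sum≈tr i n _ ⟩
      tr i n (frob 1 (1# + ε))                          ≈⟨ tr-frob i n 1 _ ⟩
      frob 1 (tr i n (1# + ε))                          ≈⟨ frob₁ _ ⟩
      tr i n (1# + ε) * tr i n (1# + ε)                 ∎
      where
      open SemiringSum semiring using (sum-cong-≋)
      x = (a Fq.^ 2 Fq.+ d Fq.^ 2) Fq.* Fq.inv e e≉0
      ιe⁻¹ : ι (Fq.inv e e≉0) ≈ ε * ε
      ιe⁻¹ = *-cancelˡ-≉0 (*-≉0 E≉0 E≉0) (begin
        E * E * ι (Fq.inv e e≉0)     ≈⟨ *-congʳ ιe≈E² ⟨
        ι e * ι (Fq.inv e e≉0)       ≈⟨ *-homo e _ ⟨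
        ι (e Fq.* Fq.inv e e≉0)      ≈⟨ trans (⟦⟧-cong (proj₂ (Fq.invertible e e≉0))) 1#-homo ⟩
        1#                           ≈⟨ E²ε²≈1 ⟨
        E * E * (ε * ε)              ∎)
      ιx : ι x ≈ frob 1 (1# + ε)
      ιx = begin
        ι x                              ≈⟨ trans (*-homo _ _) (*-cong (trans (+-homo _ _) (+-cong (ι-^ a 2) (ι-^ d 2))) ιe⁻¹) ⟩
        (a′ ^ 2 + d′ ^ 2) * (ε * ε)      ≈⟨ solve 3 (λ a d ε → (a :^ 2 :+ d :^ 2) :* (ε :* ε) := ((:1 :+ a :+ d) :* ε :+ ε) :^ 2) refl a′ d′ ε ⟩
        frob 1 (E * ε + ε)               ≈⟨ frob-cong 1 (+-congʳ Eε≈1) ⟩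
        frob 1 (1# + ε)                  ∎

  private
    m : ℕ
    m = 2 ℕ.^ ord₂ (gcd k l)
    k/m : ℕ
    k/m = _/_ k m {{m^n≢0 2 (ord₂ (gcd k l))}}
    j = proj₁ (l/m-odd k l coprime)
    l≡ = proj₂ (l/m-odd k l coprime)
    k≡ = k≡k/m*m k l coprime

  Conditions : Set _
  Conditions = Σ (¬ (e Fq.≈ Fq.0#)) (λ e≉0 →
    (d Fq.^ Q Fq.≈ e Fq.^ (Q ∸ 1) Fq.* a) ×
    (Trace Fq (2 ℕ.^ m) k/m ((a Fq.^ 2 Fq.+ d Fq.^ 2) Fq.* Fq.inv e e≉0) Fq.≈ Fq.0#))

  necessary : SeparatesLines a′ d′ → Conditions
  necessary sep = E≉0⇒e≉0 E≉0 , σD⇒d^Q E≉0 σD , ι≈0⇒≈0 (trans (ι-Trace E≉0 m k/m (E≉0⇒e≉0 E≉0)) (trans (*-congʳ trace≈0) (zeroˡ _)))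
    where
    E≉0 = separates⇒E≉0 sep
    Eε = Eε≈1 E≉0
    σD = separates⇒σD (fixed-ι a) (fixed-ι d) Eε sep
    σD+D : σ (D₀ E≉0) + D₀ E≉0 ≈ (1# + ε E≉0) * (1# + ε E≉0) + (1# + ε E≉0)
    σD+D = trans (+-congʳ σD) (solve 2 (λ D ε → D :+ ε :+ ε :* ε :+ D := (:1 :+ ε) :* (:1 :+ ε) :+ (:1 :+ ε)) refl (D₀ E≉0) (ε E≉0))
    trace≈0 : tr m k/m (1# + ε E≉0) ≈ 0#
    trace≈0 = decidable-stable (_ ≟ _) λ trace≉0 →
      let (ζ , ζ̄ , σζ) = Tr≉0⇒σ+1 m k/m j k≡ l≡ (fixed-D (fixed-ι a) (fixed-ι d) Eε) σD+D trace≉0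
      in σ+1⇒¬separates (fixed-ι a) (fixed-ι d) Eε ζ̄ σζ sep

  sufficient : Conditions → SeparatesLines a′ d′
  sufficient (e≉0 , d^Q , Tr≈0) = separates (fixed-ι a) (fixed-ι d) (Eε≈1 E≉0) (d^Q⇒σD E≉0 d^Q)
    (λ ζ ζ̄ σζ → *-≉0 1≉0 1≉0 (begin
      1# * 1#                                                    ≈⟨ *-cong (σ+1⇒Tr≈1 m k/m j k≡ l≡ ζ̄ σζ) (σ+1⇒Tr≈1 m k/m j k≡ l≡ ζ̄ σζ) ⟨
      tr m k/m (1# + ε E≉0) * tr m k/m (1# + ε E≉0)              ≈⟨ ι-Trace E≉0 m k/m e≉0 ⟨
      ι (Trace Fq (2 ℕ.^ m) k/m _)                               ≈⟨ ≈0⇒ι≈0 Tr≈0 ⟩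
      0#                                                         ∎))
    where E≉0 = e≉0⇒E≉0 e≉0

  permutes⇔conditions : Permutes f ⇔ Conditions
  permutes⇔conditions = mk⇔ (necessary ∘ permutes⇒separates) (separates⇒permutes ∘ sufficient)

corollary9p9 : ∀ {c₁ ℓ₁ c₂ ℓ₂ : Level}
    (k l : ℕ) → .{{_ : NonZero k}} → .{{_ : NonZero l}} →
    let m = 2 ℕ.^ ord₂ (gcd k l)
        q = 2 ℕ.^ k
        Q = 2 ℕ.^ l
        k/m = _/_ k m {{m^n≢0 2 (ord₂ (gcd k l))}}
    in
    gcd (Q ∸ 1) (1 ℕ.+ q) ≡ 1 →
    (Fq : Field c₁ ℓ₁) → HasOrder Fq q →
    (Fq² : Field c₂ ℓ₂) → HasOrder Fq² (q ℕ.^ 2) →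
    (ι : Field.Carrier Fq → Field.Carrier Fq²) → IsFieldEmbedding Fq Fq² ι →
    (a d : Field.Carrier Fq) →
    (u v : ℕ) → .{{_ : NonZero u}} → .{{_ : NonZero v}} →
    (u ℕ.* (Q ∸ 1)) % (1 ℕ.+ q) ≡ Q % (1 ℕ.+ q) →
    (v ℕ.* (Q ∸ 1)) % (1 ℕ.+ q) ≡ q % (1 ℕ.+ q) →
    let open Field Fq
        open Polynomials Fq²
        A = con (Field.1# Fq²) +ₚ con (ι a) *ₚ X ^ₚ u +ₚ con (ι d) *ₚ X ^ₚ v
        f = X *ₚ (A ⟨ X ^ₚ (q ∸ 1) ⟩)
        e = 1# + a ^ 2 + d ^ 2
    in
    Permutes f ⇔
      Σ (¬ (e ≈ 0#)) (λ e≉0 →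
        (d ^ Q ≈ e ^ (Q ∸ 1) * a) ×
        (Trace Fq (2 ℕ.^ m) k/m ((a ^ 2 + d ^ 2) * inv e e≉0) ≈ 0#))
corollary9p9 k l coprime Fq order-q Fq² order-q² ι embedding a d u v u≡ v≡ =
  Main.permutes⇔conditions k l coprime Fq order-q Fq² order-q² ι embedding a d u v u≡ v≡
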